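{- Let $H$ be a covering $3$-hypergraph of order $n\geq 7$. Then $H$ is eulerian.
   Context: A hypergraph $H=(V,E)$ has a finite non-empty vertex set $V$ and a finite multiset $E$ of subsets of $V$ (edges; distinct members of the multiset are distinct edges); its order is $|V|$. A covering $3$-hypergraph is a hypergraph with at least one edge, all of whose edges have exactly 3 elements, in which every pair of distinct vertices is contained in at least one edge. A walk is a sequence $v_0e_1v_1\dots e_mv_m$ with $v_i\in V$, $e_i\in E$, $v_{i-1},v_i\in e_i$, $v_{i-1}\neq v_i$; it is a trail if the $e_i$ are pairwise distinct, and closed if $v_0=v_m$ and $m\ge2$. An Euler tour is a closed trail traversing every edge exactly once; $H$ is eulerian if it has no edges or admits an Euler tour. -}

module Defs where

open import Data.Nat using (ℕ; zero; suc; _≤_)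
open import Data.Fin using (Fin; zero; suc; inject₁; fromℕ)
open import Data.Fin.Subset using (Subset; _∈_; ∣_∣)
open import Data.Product using (Σ; ∃; ∃-syntax; _×_; _,_)
open import Data.Sum using (_⊎_)
open import Relation.Binary.PropositionalEquality using (_≡_; _≢_)
open import Function.Definitions using (Injective; Surjective)

-- A hypergraph on vertex set Fin n (order n; non-empty when n ≥ 1) with a
-- finite multiset of edges, given as an indexed family Fin m → Subset n
-- (distinct indices = distinct edges, so repeated edges are allowed).
record Hypergraph (n : ℕ) : Set where
  field
    m    : ℕ
    edge : Fin m → Subset n
open Hypergraph public

record Covering3 {n : ℕ} (H : Hypergraph n) : Set where
  field
    nonempty : 1 ≤ m H
    uniform  : ∀ (e : Fin (m H)) → ∣ edge H e ∣ ≡ 3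
    covers   : ∀ (u v : Fin n) → u ≢ v →
               ∃[ e ] (u ∈ edge H e × v ∈ edge H e)

record Walk {n : ℕ} (H : Hypergraph n) (k : ℕ) : Set where
  field
    vtx   : Fin (suc k) → Fin n
    edg   : Fin k → Fin (m H)
    inˡ   : ∀ i → vtx (inject₁ i) ∈ edge H (edg i)
    inʳ   : ∀ i → vtx (suc i) ∈ edge H (edg i)
    step≢ : ∀ i → vtx (inject₁ i) ≢ vtx (suc i)
open Walk public

IsTrail : ∀ {n k} {H : Hypergraph n} → Walk H k → Set
IsTrail w = Injective _≡_ _≡_ (edg w)

IsClosed : ∀ {n k} {H : Hypergraph n} → Walk H k → Set
IsClosed {k = k} w = (vtx w zero ≡ vtx w (fromℕ k)) × (2 ≤ k)

IsEulerTour : ∀ {n k} {H : Hypergraph n} → Walk H k → Set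
IsEulerTour w = IsClosed w × IsTrail w × Surjective _≡_ _≡_ (edg w)

Eulerian : ∀ {n} → Hypergraph n → Set
Eulerian H = (m H ≡ 0) ⊎ (∃[ k ] Σ (Walk H k) IsEulerTour)

{-# OPTIONS --safe #-}

-- In an Euler tour each edge is crossed between two of its vertices and skips the third.  Changing
-- the skipped vertex from t to p moves one end of a step from p to t, and cyclic chains of such
-- changes preserve the even degrees.
--
-- A tree of such changes that spans all vertices uses each edge at most once and lets the parity
-- be corrected leaf by leaf; hence the edges split into closed trails.  Take disjoint closed trails
-- and write p ⇒ q if some edge crossed at p skips q.  Since every pair is covered, ⇒ is a
-- tournament between vertices of different trails.  Three trails always merge into at most two,
-- whether the three base vertices form a cyclic or a transitive triangle.
--
-- For two trails C₁, C₂ that do not merge, with C₁ of minimal length: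
-- * if no vertex of C₁ dominates one of C₂, fix q on C₂.  The steps of C₂ at q skipping p and t
--   must be traversed in opposite directions whenever a rerouted C₁ joins p to t.  So adjacent
--   vertices of C₁ have equal directions, opposite to that of the skipped vertex, which is then
--   the same unvisited vertex w for all steps; a detour through w joins adjacent vertices.
-- * if p ⇒ q ⇒ t for some p, t on C₁, then the set dominated by p can be replaced by a smaller
--   one, by a square p ⇒ q ⇒ s ⇒ q′ ⇒ p of changes, until it is a single vertex, which is absurd.
-- * otherwise a single vertex q₀ of C₂ is dominated by all of C₁, and a step of C₂ at q₀, together
--   with two steps of opposite directions at the vertex it skips, gives a merge.
module Submission where

open import Defs
import Algebra.Solver.CommutativeMonoid as Solver
open import Data.Bool using (Bool; true; false; not; _xor_)
open import Data.Bool.Properties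
  using (¬-not; not-involutive; xor-assoc; xor-comm; xor-same; xor-identityʳ)
open import Data.Bool.Solver using (module xor-∧-Solver)
open import Data.Empty using (⊥; ⊥-elim)
open import Data.Fin using (Fin; zero; suc; _≟_; inject₁; fromℕ)
open import Data.Fin.Properties using (any?; all?)
open import Data.Fin.Subset using (Subset; _∈_; ∣_∣; _-_; ⁅_⁆; _∪_; _⊆_)
import Data.Fin.Subset.Properties as Sub
open import Data.List using (List; []; _∷_; _++_; [_]; map; length; filter; allFin; concat; lookup)
open import Data.List.Membership.Propositional
  using (find; lose) renaming (_∈_ to _∈ˡ_; _∉_ to _∉ˡ_)
open import Data.List.Membership.Propositional.Properties
  using (∈-++⁻; ∈-∃++; ∈-map⁻; ∈-filter⁺; ∈-allFin; ∈-concat⁻′; ∈-lookup)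
open import Data.List.Properties
  using (map-++; ++-assoc; ++-identityʳ; length-++; length-map; length-tabulate; filter-notAll;
         concat-++)
open import Data.List.Relation.Binary.Permutation.Propositional
  using (_↭_; ↭-refl; ↭-sym; ↭-trans; ↭-reflexive; prep; ↭⇒↭ₛ)
open import Data.List.Relation.Binary.Permutation.Propositional.Properties
  using (++⁺; ++⁺ˡ; ++⁺ʳ; ++-comm; ↭-length; ∈-resp-↭; shift; shifts; ++-commutativeMonoid)
open import Data.List.Relation.Binary.Permutation.Setoid.Properties using (Unique-resp-↭)
open import Data.List.Relation.Unary.All as All using (All; []; _∷_)
open import Data.List.Relation.Unary.All.Properties using (++⁻) renaming (++⁺ to ++⁺ᴬ)
open import Data.List.Relation.Unary.AllPairs using ([]; _∷_)
open import Data.List.Relation.Unary.Any as Any using (Any; here; there; index)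
open import Data.List.Relation.Unary.Any.Properties using (lookup-index)
open import Data.List.Relation.Unary.Unique.DecPropositional using (unique?)
open import Data.List.Relation.Unary.Unique.Propositional using (Unique)
open import Data.List.Relation.Unary.Unique.Propositional.Properties using (allFin⁺)
open import Data.Nat using (ℕ; zero; suc; _+_; _≤_; _<_; z≤n; s≤s)
import Data.Nat.Properties as ℕₚ
open import Data.Product using (Σ; ∃₂; ∃-syntax; _×_; _,_; proj₁; proj₂)
open import Data.Sum using (_⊎_; inj₁; inj₂; swap)
import Data.Vec as Vec
open import Function using (_∘_; case_of_)
open import Relation.Binary.PropositionalEquality
  using (_≡_; _≢_; refl; sym; trans; cong; cong₂; subst; ≢-sym; setoid; module ≡-Reasoning)
open import Relation.Nullary using (¬_; Dec; yes; no; does; contradiction)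
open import Relation.Nullary.Decidable
  using (_×-dec_; _⊎-dec_; ¬?; dec-true; dec-false; decidable-stable)

-- Sets with three elements.

module _ {n : ℕ} {S : Subset n} (∣S∣≡3 : ∣ S ∣ ≡ 3) where

  third : ∀ {u v} → u ∈ S → v ∈ S → u ≢ v → ∃[ w ] (w ∈ S × w ≢ u × w ≢ v)
  third {u} {v} u∈ v∈ u≢v with any? (λ w → w Sub.∈? S ×-dec (¬? (w ≟ u) ×-dec ¬? (w ≟ v)))
  ... | yes found = found
  ... | no none = contradiction (ℕₚ.≤-trans (Sub.p⊆q⇒∣p∣≤∣q∣ S⊆) (∣∪∣≤ ⁅ u ⁆ ⁅ v ⁆)) too-big
    where
    S⊆ : S ⊆ ⁅ u ⁆ ∪ ⁅ v ⁆
    S⊆ {w} w∈ with w ≟ u | w ≟ v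
    ... | yes refl | _ = Sub.x∈p∪q⁺ (inj₁ (Sub.x∈⁅x⁆ w))
    ... | no _ | yes refl = Sub.x∈p∪q⁺ (inj₂ (Sub.x∈⁅x⁆ w))
    ... | no w≢u | no w≢v = contradiction (w , w∈ , w≢u , w≢v) none
    ∣∪∣≤ : ∀ {k} (p q : Subset k) → ∣ p ∪ q ∣ ≤ ∣ p ∣ + ∣ q ∣
    ∣∪∣≤ Vec.[] Vec.[] = z≤n
    ∣∪∣≤ (true Vec.∷ p) (true Vec.∷ q) =
      s≤s (ℕₚ.≤-trans (∣∪∣≤ p q) (ℕₚ.+-monoʳ-≤ ∣ p ∣ (ℕₚ.n≤1+n _)))
    ∣∪∣≤ (true Vec.∷ p) (false Vec.∷ q) = s≤s (∣∪∣≤ p q)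
    ∣∪∣≤ (false Vec.∷ p) (true Vec.∷ q) =
      ℕₚ.≤-trans (s≤s (∣∪∣≤ p q)) (ℕₚ.≤-reflexive (sym (ℕₚ.+-suc ∣ p ∣ ∣ q ∣)))
    ∣∪∣≤ (false Vec.∷ p) (false Vec.∷ q) = ∣∪∣≤ p q
    too-big : ¬ (∣ S ∣ ≤ ∣ ⁅ u ⁆ ∣ + ∣ ⁅ v ⁆ ∣)
    too-big le rewrite ∣S∣≡3 | Sub.∣⁅x⁆∣≡1 u | Sub.∣⁅x⁆∣≡1 v with le
    ... | s≤s (s≤s ())

  -- Deleting four distinct elements one at a time would force the size to be at least four.
  only-three : ∀ {a b c x} → a ∈ S → b ∈ S → c ∈ S → a ≢ b → a ≢ c → b ≢ c →
               x ∈ S → x ≡ a ⊎ x ≡ b ⊎ x ≡ c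
  only-three {a} {b} {c} {x} a∈ b∈ c∈ a≢b a≢c b≢c x∈ with x ≟ a | x ≟ b | x ≟ c
  ... | yes e | _ | _ = inj₁ e
  ... | no _ | yes e | _ = inj₂ (inj₁ e)
  ... | no _ | no _ | yes e = inj₂ (inj₂ e)
  ... | no x≢a | no x≢b | no x≢c = contradiction four≤ (ℕₚ.<⇒≱ (s≤s (ℕₚ.≤-reflexive ∣S∣≡3)))
    where
    shrink : ∀ {p : Subset n} {y k} → y ∈ p → k ≤ ∣ p - y ∣ → suc k ≤ ∣ p ∣
    shrink y∈ k≤ = ℕₚ.≤-trans (s≤s k≤) (Sub.x∈p⇒∣p-x∣<∣p∣ y∈)
    keep : ∀ {p : Subset n} {y z} → y ∈ p → y ≢ z → y ∈ p - z
    keep = Sub.x∈p∧x≢y⇒x∈p-y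
    four≤ : 4 ≤ ∣ S ∣
    four≤ = shrink a∈ (shrink (keep b∈ (≢-sym a≢b))
      (shrink (keep (keep c∈ (≢-sym a≢c)) (≢-sym b≢c))
        (shrink (keep (keep (keep x∈ x≢a) x≢b) x≢c) z≤n)))

-- Trails, and how they are cut and rerouted.

module Trails {n : ℕ} (H : Hypergraph n) where

  Vertex Edge : Set
  Vertex = Fin n
  Edge = Fin (m H)

  open Solver (++-commutativeMonoid {A = Edge}) public using (solve; _⊜_; _⊕_)

  record Arc : Set where
    constructor arc
    field
      via : Edge
      src tgt : Vertex
      src∈ : src ∈ edge H via
      tgt∈ : tgt ∈ edge H via
      src≢tgt : src ≢ tgt
  open Arc public

  edges : List Arc → List Edge
  edges = map via

  data Path : Vertex → Vertex → List Arc → Set where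
    []   : ∀ {a} → Path a a []
    step : ∀ {a b} k {ks} → src k ≡ a → Path (tgt k) b ks → Path a b (k ∷ ks)

  _++ᵖ_ : ∀ {a b c ks ls} → Path a b ks → Path b c ls → Path a c (ks ++ ls)
  [] ++ᵖ q = q
  step k e p ++ᵖ q = step k e (p ++ᵖ q)

  splitᵖ : ∀ {a b} ks {ls} → Path a b (ks ++ ls) → ∃[ c ] (Path a c ks × Path c b ls)
  splitᵖ [] p = _ , [] , p
  splitᵖ (k ∷ ks) (step .k e p) with splitᵖ ks p
  ... | c , q , r = c , step k e q , r

  -- Edges are recorded only up to permutation, so that a rerouted trail is compared with the old
  -- one by the commutative-monoid solver.
  Trail : Vertex → Vertex → List Edge → Set
  Trail a b es = ∃[ ks ] (Path a b ks × edges ks ↭ es)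

  ClosedTrail : List Edge → Set
  ClosedTrail es = ∃[ v ] Trail v v es

  trail : ∀ {a b ks} → Path a b ks → Trail a b (edges ks)
  trail p = _ , p , ↭-refl

  reorder : ∀ {a b es fs} → es ↭ fs → Trail a b es → Trail a b fs
  reorder σ (ks , p , τ) = ks , p , ↭-trans τ σ

  infixr 5 _⟫_
  _⟫_ : ∀ {a b c es fs} → Trail a b es → Trail b c fs → Trail a c (es ++ fs)
  (ks , p , σ) ⟫ (ls , q , τ) =
    ks ++ ls , p ++ᵖ q , ↭-trans (↭-reflexive (map-++ via ks ls)) (++⁺ σ τ)

  hop : ∀ {u v e} → u ∈ edge H e → v ∈ edge H e → u ≢ v → Trail u v [ e ]
  hop u∈ v∈ u≢v = _ , step (arc _ _ _ u∈ v∈ u≢v) refl [] , ↭-refl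

  flipped : ∀ {a b es} → Trail a b es → Trail b a es
  flipped (_ , p , σ) = reorder σ (back p)
    where
    back : ∀ {a b ks} → Path a b ks → Trail b a (edges ks)
    back [] = trail []
    back (step k {ks} refl p) =
      reorder (++-comm (edges ks) [ via k ]) (back p ⟫ hop (tgt∈ k) (src∈ k) (≢-sym (src≢tgt k)))

  private
    split-at : ∀ {a b ks k} → Path a b ks → k ∈ˡ ks →
               ∃₂ λ As Bs → ks ≡ As ++ k ∷ Bs × Path a (src k) As × Path (tgt k) b Bs
    split-at p k∈ with ∈-∃++ k∈
    ... | As , Bs , refl with splitᵖ As p
    ...   | _ , q , step _ refl r = As , Bs , refl , q , r

  -- The part after `k` is followed, through the base point `x`, by the part before it.
  cut : ∀ {x ks k} → Path x x ks → k ∈ˡ ks →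
        ∃[ A ] (via k ∷ A ↭ edges ks × Trail (tgt k) (src k) A)
  cut {k = k} p k∈ with split-at p k∈
  ... | As , Bs , refl , q , r = _ , σ , trail r ⟫ trail q
    where
    σ : via k ∷ edges Bs ++ edges As ↭ edges (As ++ k ∷ Bs)
    σ rewrite map-++ via As (k ∷ Bs) =
      solve 3 (λ e a b → e ⊕ b ⊕ a ⊜ a ⊕ e ⊕ b) ↭-refl [ via k ] (edges As) (edges Bs)

  -- The base point lies on the piece `A` if `l` precedes `k`, and on `B` otherwise.
  cut-two : ∀ {x ks k l} → Path x x ks → k ∈ˡ ks → l ∈ˡ ks → k ≢ l →
            ∃₂ λ A B → via k ∷ via l ∷ A ++ B ↭ edges ks ×
                       Trail (tgt k) (src l) A × Trail (tgt l) (src k) B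
  cut-two {k = k} {l} p k∈ l∈ k≢l with split-at p k∈
  ... | As , Bs , refl , q , r with ∈-++⁻ As l∈
  ...   | inj₁ l∈As with split-at q l∈As
  ...     | Cs , Ds , refl , q₁ , q₂ = _ , _ , σ , trail r ⟫ trail q₁ , trail q₂
    where
    σ : via k ∷ via l ∷ (edges Bs ++ edges Cs) ++ edges Ds ↭ edges ((Cs ++ l ∷ Ds) ++ k ∷ Bs)
    σ rewrite map-++ via (Cs ++ l ∷ Ds) (k ∷ Bs) | map-++ via Cs (l ∷ Ds) =
      solve 5 (λ e f b c d → e ⊕ f ⊕ (b ⊕ c) ⊕ d ⊜ (c ⊕ f ⊕ d) ⊕ e ⊕ b) ↭-refl
        [ via k ] [ via l ] (edges Bs) (edges Cs) (edges Ds)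
  cut-two {k = k} {l} p k∈ l∈ k≢l | As , Bs , refl , q , r | inj₂ (here refl) = contradiction refl k≢l
  cut-two {k = k} {l} p k∈ l∈ k≢l | As , Bs , refl , q , r | inj₂ (there l∈Bs) with split-at r l∈Bs
  ... | Cs , Ds , refl , r₁ , r₂ = _ , _ , σ , trail r₁ , trail r₂ ⟫ trail q
    where
    σ : via k ∷ via l ∷ edges Cs ++ edges Ds ++ edges As ↭ edges (As ++ k ∷ Cs ++ l ∷ Ds)
    σ rewrite map-++ via As (k ∷ Cs ++ l ∷ Ds) | map-++ via Cs (l ∷ Ds) =
      solve 5 (λ e f a c d → e ⊕ f ⊕ c ⊕ d ⊕ a ⊜ a ⊕ e ⊕ c ⊕ f ⊕ d) ↭-refl
        [ via k ] [ via l ] (edges As) (edges Cs) (edges Ds)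

  Joins : Arc → Vertex → Vertex → Set
  Joins k u v = (src k ≡ u × tgt k ≡ v) ⊎ (src k ≡ v × tgt k ≡ u)

  -- t is the vertex of the edge that the arc between p and r skips.
  record Link (ks : List Arc) (p r t : Vertex) : Set where
    constructor link
    field
      on    : Arc
      on∈   : on ∈ˡ ks
      joins : Joins on p r
      t∈    : t ∈ edge H (via on)
      t≢p   : t ≢ p
      t≢r   : t ≢ r
  open Link public

  swapˡ : ∀ {ks p r t} → Link ks p r t → Link ks r p t
  swapˡ l = link (on l) (on∈ l) (swap (joins l)) (t∈ l) (t≢r l) (t≢p l)

  p∈ : ∀ {ks p r t} (l : Link ks p r t) → p ∈ edge H (via (on l))
  p∈ (link k _ (inj₁ (refl , _)) _ _ _) = src∈ k
  p∈ (link k _ (inj₂ (_ , refl)) _ _ _) = tgt∈ k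

  r∈ : ∀ {ks p r t} (l : Link ks p r t) → r ∈ edge H (via (on l))
  r∈ l = p∈ (swapˡ l)

  p≢r : ∀ {ks p r t} → Link ks p r t → p ≢ r
  p≢r (link k _ (inj₁ (refl , refl)) _ _ _) = src≢tgt k
  p≢r (link k _ (inj₂ (refl , refl)) _ _ _) = ≢-sym (src≢tgt k)

  -- The direction of traversal as seen from `p`. Only comparisons between two links of one trail
  -- carry information, since reversing the trail flips them all.
  leaves : ∀ {ks p r t} → Link ks p r t → Bool
  leaves (link _ _ (inj₁ _) _ _ _) = true
  leaves (link _ _ (inj₂ _) _ _ _) = false

  module _ {x ks} (P : Path x x ks) where

    cut-link : ∀ {p r t} (l : Link ks p r t) →
               ∃[ A ] (via (on l) ∷ A ↭ edges ks × Trail r p A)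
    cut-link (link k k∈ (inj₁ (refl , refl)) _ _ _) = cut P k∈
    cut-link (link k k∈ (inj₂ (refl , refl)) _ _ _) with cut P k∈
    ... | A , σ , c = A , σ , flipped c

    -- A link ignores the direction of its arc, so every combination reduces to `cut-two` after
    -- flipping the pieces. Equal directions pair `r` with `p′` and `r′` with `p`; opposite ones
    -- pair `r` with `r′` and `p` with `p′`.
    cut-links : ∀ {p r t p′ r′ t′} (l : Link ks p r t) (l′ : Link ks p′ r′ t′) → on l ≢ on l′ →
                ∃₂ λ A B → via (on l) ∷ via (on l′) ∷ A ++ B ↭ edges ks ×
                  ((leaves l ≡ leaves l′ × Trail r p′ A × Trail r′ p B) ⊎
                   (leaves l ≢ leaves l′ × Trail r r′ A × Trail p′ p B))
    cut-links (link k k∈ (inj₁ (refl , refl)) _ _ _) (link l l∈ (inj₁ (refl , refl)) _ _ _) k≢l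
      with cut-two P k∈ l∈ k≢l
    ... | A , B , σ , c , d = A , B , σ , inj₁ (refl , c , d)
    cut-links (link k k∈ (inj₂ (refl , refl)) _ _ _) (link l l∈ (inj₂ (refl , refl)) _ _ _) k≢l
      with cut-two P k∈ l∈ k≢l
    ... | A , B , σ , c , d =
      B , A , ↭-trans (prep _ (prep _ (++-comm B A))) σ , inj₁ (refl , flipped d , flipped c)
    cut-links (link k k∈ (inj₁ (refl , refl)) _ _ _) (link l l∈ (inj₂ (refl , refl)) _ _ _) k≢l
      with cut-two P k∈ l∈ k≢l
    ... | A , B , σ , c , d = A , B , σ , inj₂ ((λ ()) , c , d)
    cut-links (link k k∈ (inj₂ (refl , refl)) _ _ _) (link l l∈ (inj₁ (refl , refl)) _ _ _) k≢l
      with cut-two P k∈ l∈ k≢l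
    ... | A , B , σ , c , d =
      B , A , ↭-trans (prep _ (prep _ (++-comm B A))) σ , inj₂ ((λ ()) , flipped d , flipped c)

    -- One end of the step moves from `p` to the skipped vertex `t`: the closed trail is opened at
    -- `p` and finishes by crossing the same edge from `r` to `t`.
    detour : ∀ {p r t} → Link ks p r t → Trail p t (edges ks)
    detour l with cut-link l
    ... | A , σ , c = reorder (↭-trans (++-comm A _) σ) (flipped c ⟫ hop (r∈ l) (t∈ l) (≢-sym (t≢r l)))

    at-start : ∀ {p r t} → Link ks p r t → Trail p p (edges ks)
    at-start l with cut-link l
    ... | A , σ , c = reorder σ (hop (p∈ l) (r∈ l) (p≢r l) ⟫ c)

    -- Reroutes the arcs l and l′ away from p, to the ends α and β of a foreign trail.
    reroute : ∀ {p r r′ α β R} (l : Link ks p r α) (l′ : Link ks p r′ β) → on l ≢ on l′ → Trail α β R →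
              (leaves l ≡ leaves l′ × Trail α α (edges ks ++ R)) ⊎
              (leaves l ≢ leaves l′ ×
                ∃₂ λ A B → Trail α α A × Trail p p B × A ++ B ↭ edges ks ++ R × length B < length ks)
    reroute {R = R} l l′ l≢l′ ρ with cut-links l l′ l≢l′
    ... | A , B , σ , inj₁ (same , a , b) =
      inj₁ (same , reorder τ (hop (t∈ l) (r∈ l) (t≢r l) ⟫ a ⟫ flipped b
                                ⟫ hop (r∈ l′) (t∈ l′) (≢-sym (t≢r l′)) ⟫ flipped ρ))
      where
      τ = ↭-trans
        (solve 5 (λ e a b f r → e ⊕ a ⊕ b ⊕ f ⊕ r ⊜ (e ⊕ f ⊕ a ⊕ b) ⊕ r) ↭-refl
          [ via (on l) ] A B [ via (on l′) ] R)
        (++⁺ʳ R σ)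
    ... | A , B , σ , inj₂ (opposite , a , b) =
      inj₂ (opposite , _ , B
           , hop (t∈ l) (r∈ l) (t≢r l) ⟫ a ⟫ hop (r∈ l′) (t∈ l′) (≢-sym (t≢r l′)) ⟫ flipped ρ , b
           , τ , shorter)
      where
      τ = ↭-trans
        (solve 5 (λ e a b f r → (e ⊕ a ⊕ f ⊕ r) ⊕ b ⊜ (e ⊕ f ⊕ a ⊕ b) ⊕ r) ↭-refl
          [ via (on l) ] A B [ via (on l′) ] R)
        (++⁺ʳ R σ)
      shorter : length B < length ks
      shorter = begin-strict
        length B                    ≤⟨ ℕₚ.m≤n+m (length B) (length A) ⟩
        length A + length B         ≡⟨ length-++ A ⟨
        length (A ++ B)             <⟨ ℕₚ.n<1+n _ ⟩
        suc (length (A ++ B))       <⟨ ℕₚ.n<1+n _ ⟩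
        suc (suc (length (A ++ B))) ≡⟨ ↭-length σ ⟩
        length (edges ks)           ≡⟨ length-map via ks ⟩
        length ks                   ∎
        where open ℕₚ.≤-Reasoning

  Visits : List Arc → Vertex → Set
  Visits ks v = Any (λ k → src k ≡ v ⊎ tgt k ≡ v) ks

  visits? : ∀ ks v → Dec (Visits ks v)
  visits? ks v = Any.any? (λ k → (src k ≟ v) ⊎-dec (tgt k ≟ v)) ks

  link-visits : ∀ {ks p r t} → Link ks p r t → Visits ks p
  link-visits (link k k∈ (inj₁ (e , _)) _ _ _) = lose k∈ (inj₁ e)
  link-visits (link k k∈ (inj₂ (_ , e)) _ _ _) = lose k∈ (inj₂ e)

  visited : ∀ {x ks v} → Path x x ks → Visits ks v → Trail v v (edges ks)
  visited P vis with find vis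
  ... | k , k∈ , end with cut P k∈
  ...   | A , σ , c with end
  ...     | inj₁ refl = reorder σ (hop (src∈ k) (tgt∈ k) (src≢tgt k) ⟫ c)
  ...     | inj₂ refl = reorder (↭-trans (++-comm A _) σ) (c ⟫ hop (src∈ k) (tgt∈ k) (src≢tgt k))

-- Skipped vertices and covered pairs.

module Links {n : ℕ} (H : Hypergraph n) (uniform : ∀ e → ∣ edge H e ∣ ≡ 3) where
  open Trails H

  -- The two ends of the arc leave only one vertex of its edge. Mostly used in contrapositive form:
  -- links that skip different vertices lie on different arcs.
  same-third : ∀ {ks ks′ p r t p′ r′ t′} (l : Link ks p r t) (l′ : Link ks′ p′ r′ t′) →
               on l ≡ on l′ → t ≡ t′
  same-third l@(link k _ j _ _ _) (link .k _ j′ t′∈ t′≢p′ t′≢r′) refl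
    with only-three (uniform (via k)) (p∈ l) (r∈ l) (t∈ l) (p≢r l) (≢-sym (t≢p l)) (≢-sym (t≢r l)) t′∈
  ... | inj₂ (inj₂ e) = sym e
  ... | inj₁ e = ⊥-elim (end j j′ e)
    where
    end : Joins k _ _ → Joins k _ _ → _ ≡ _ → ⊥
    end (inj₁ (refl , _)) (inj₁ (refl , _)) e = t′≢p′ e
    end (inj₁ (refl , _)) (inj₂ (refl , _)) e = t′≢r′ e
    end (inj₂ (_ , refl)) (inj₁ (_ , refl)) e = t′≢r′ e
    end (inj₂ (_ , refl)) (inj₂ (_ , refl)) e = t′≢p′ e
  ... | inj₂ (inj₁ e) = ⊥-elim (end j j′ e)
    where
    end : Joins k _ _ → Joins k _ _ → _ ≡ _ → ⊥
    end (inj₁ (_ , refl)) (inj₁ (_ , refl)) e = t′≢r′ e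
    end (inj₁ (_ , refl)) (inj₂ (_ , refl)) e = t′≢p′ e
    end (inj₂ (refl , _)) (inj₁ (refl , _)) e = t′≢p′ e
    end (inj₂ (refl , _)) (inj₂ (refl , _)) e = t′≢r′ e

  same-far-end : ∀ {ks ks′ p r t r′ t′} (l : Link ks p r t) (l′ : Link ks′ p r′ t′) →
                 on l ≡ on l′ → r ≡ r′
  same-far-end (link k _ (inj₁ (refl , refl)) _ _ _) (link .k _ (inj₁ (_ , e)) _ _ _) refl = e
  same-far-end (link k _ (inj₁ (refl , refl)) _ _ _) (link .k _ (inj₂ (_ , e)) _ _ _) refl =
    contradiction (sym e) (src≢tgt k)
  same-far-end (link k _ (inj₂ (refl , refl)) _ _ _) (link .k _ (inj₁ (e , _)) _ _ _) refl =
    contradiction e (src≢tgt k)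
  same-far-end (link k _ (inj₂ (refl , refl)) _ _ _) (link .k _ (inj₂ (e , _)) _ _ _) refl = e

  -- An arc skips only one vertex of its edge, so an edge of the trail can contain both `x` and `y`
  -- in these three ways only; each of them puts `x` or `y` on the trail.
  data Covers (ks : List Arc) (x y : Vertex) : Set where
    both  : ∀ {t} → Link ks x y t → Covers ks x y
    left  : ∀ {r} → Link ks x r y → Covers ks x y
    right : ∀ {r} → Link ks y r x → Covers ks x y

  arc-covers : ∀ {ks k x y} → k ∈ˡ ks → x ∈ edge H (via k) → y ∈ edge H (via k) → x ≢ y → Covers ks x y
  arc-covers {ks} {k} {x} {y} k∈ x∈ y∈ x≢y with third (uniform (via k)) (src∈ k) (tgt∈ k) (src≢tgt k)
  ... | t , t∈ , t≢src , t≢tgt = choose (ends x∈) (ends y∈)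
    where
    l : Link ks (src k) (tgt k) t
    l = link k k∈ (inj₁ (refl , refl)) t∈ t≢src t≢tgt
    ends : ∀ {v} → v ∈ edge H (via k) → v ≡ src k ⊎ v ≡ tgt k ⊎ v ≡ t
    ends = only-three (uniform (via k)) (src∈ k) (tgt∈ k) t∈ (src≢tgt k) (≢-sym t≢src) (≢-sym t≢tgt)
    choose : x ≡ src k ⊎ x ≡ tgt k ⊎ x ≡ t → y ≡ src k ⊎ y ≡ tgt k ⊎ y ≡ t → Covers ks x y
    choose (inj₁ refl)        (inj₁ refl)        = contradiction refl x≢y
    choose (inj₁ refl)        (inj₂ (inj₁ refl)) = both l
    choose (inj₁ refl)        (inj₂ (inj₂ refl)) = left l
    choose (inj₂ (inj₁ refl)) (inj₁ refl)        = both (swapˡ l)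
    choose (inj₂ (inj₁ refl)) (inj₂ (inj₁ refl)) = contradiction refl x≢y
    choose (inj₂ (inj₁ refl)) (inj₂ (inj₂ refl)) = left (swapˡ l)
    choose (inj₂ (inj₂ refl)) (inj₁ refl)        = right l
    choose (inj₂ (inj₂ refl)) (inj₂ (inj₁ refl)) = right (swapˡ l)
    choose (inj₂ (inj₂ refl)) (inj₂ (inj₂ refl)) = contradiction refl x≢y

  edge-covers : ∀ {ks e x y} → e ∈ˡ edges ks → x ∈ edge H e → y ∈ edge H e → x ≢ y → Covers ks x y
  edge-covers e∈ x∈ y∈ x≢y with ∈-map⁻ via e∈
  ... | k , k∈ , refl = arc-covers k∈ x∈ y∈ x≢y

  private
    successor : ∀ {a b ks k} → Path a b ks → k ∈ˡ ks → tgt k ≡ b ⊎ ∃[ l ] (l ∈ˡ ks × src l ≡ tgt k)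
    successor (step k _ []) (here refl) = inj₁ refl
    successor (step k _ (step l e _)) (here refl) = inj₂ (l , there (here refl) , e)
    successor (step _ _ p) (there k∈) with successor p k∈
    ... | inj₁ e = inj₁ e
    ... | inj₂ (l , l∈ , e) = inj₂ (l , there l∈ , e)

    predecessor : ∀ {a b ks k} → Path a b ks → k ∈ˡ ks → src k ≡ a ⊎ ∃[ l ] (l ∈ˡ ks × tgt l ≡ src k)
    predecessor (step k e _) (here refl) = inj₁ e
    predecessor (step l _ p) (there k∈) with predecessor p k∈
    ... | inj₁ e = inj₂ (l , here refl , sym e)
    ... | inj₂ (l′ , l∈ , e) = inj₂ (l′ , there l∈ , e)

    first : ∀ {a b ks k} → Path a b ks → k ∈ˡ ks → ∃[ l ] (l ∈ˡ ks × src l ≡ a)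
    first (step l e _) _ = l , here refl , e

    last : ∀ {a b ks k} → Path a b ks → k ∈ˡ ks → ∃[ l ] (l ∈ˡ ks × tgt l ≡ b)
    last (step k e []) _ = k , here refl , refl
    last (step _ _ p@(step _ _ _)) _ with last p (here refl)
    ... | l , l∈ , e = l , there l∈ , e

  arc-to : ∀ {ks v} k → k ∈ˡ ks → tgt k ≡ v → ∃[ t ] Σ (Link ks v (src k) t) λ l → on l ≡ k
  arc-to k k∈ refl with third (uniform (via k)) (src∈ k) (tgt∈ k) (src≢tgt k)
  ... | t , t∈ , t≢src , t≢tgt = t , link k k∈ (inj₂ (refl , refl)) t∈ t≢tgt t≢src , refl

  arc-from : ∀ {ks v} k → k ∈ˡ ks → src k ≡ v → ∃[ t ] Σ (Link ks v (tgt k) t) λ l → on l ≡ k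
  arc-from k k∈ refl with third (uniform (via k)) (src∈ k) (tgt∈ k) (src≢tgt k)
  ... | t , t∈ , t≢src , t≢tgt = t , link k k∈ (inj₁ (refl , refl)) t∈ t≢src t≢tgt , refl

  -- The cyclically preceding or following arc at `p` serves; it is a different arc because no arc
  -- is a loop.
  other-link : ∀ {x ks p r t} → Path x x ks → (l : Link ks p r t) →
               ∃₂ λ y z → Σ (Link ks p y z) λ l′ → on l ≢ on l′
  other-link {ks = ks} P (link k k∈ (inj₁ (refl , refl)) _ _ _) with preceding
    where
    preceding : ∃[ l ] (l ∈ˡ ks × tgt l ≡ src k)
    preceding with predecessor P k∈
    ... | inj₂ found = found
    ... | inj₁ refl = last P k∈
  ... | l , l∈ , e with arc-to l l∈ e
  ...   | z , l′ , refl = _ , z , l′ , λ { refl → src≢tgt k (sym e) }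
  other-link {ks = ks} P (link k k∈ (inj₂ (refl , refl)) _ _ _) with following
    where
    following : ∃[ l ] (l ∈ˡ ks × src l ≡ tgt k)
    following with successor P k∈
    ... | inj₂ found = found
    ... | inj₁ refl = first P k∈
  ... | l , l∈ , e with arc-from l l∈ e
  ...   | z , l′ , refl = _ , z , l′ , λ { refl → src≢tgt k e }

  visits-link : ∀ {ks v} → Visits ks v → ∃₂ λ r t → Link ks v r t
  visits-link vis with find vis
  ... | k , k∈ , inj₁ e = _ , _ , proj₁ (proj₂ (arc-from k k∈ e))
  ... | k , k∈ , inj₂ e = _ , _ , proj₁ (proj₂ (arc-to k k∈ e))

-- Two closed trails that together use every edge.

module Duel {n : ℕ} {H : Hypergraph n} (cov : Covering3 H) where
  open Covering3 cov
  open Trails H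
  open Links H uniform

  -- A minimal counterexample to merging two closed trails that together use every edge.
  module Rivals
    {ks₁ ks₂ : List Arc} {x₁ x₂ : Vertex} (P₁ : Path x₁ x₁ ks₁) (P₂ : Path x₂ x₂ ks₂)
    (all : List Edge) (complete : ∀ e → e ∈ˡ all) (total : edges ks₁ ++ edges ks₂ ↭ all)
    (no-tour : ∀ {v} → ¬ Trail v v all)
    (minimal : ∀ {a b A B} → Trail a a A → Trail b b B → A ++ B ↭ all → ¬ length A < length ks₁)
    where

    private
      E₁ E₂ : List Edge
      E₁ = edges ks₁
      E₂ = edges ks₂

    -- In both relations p is a vertex of the first trail and q one of the second.
    _⇒_ : Vertex → Vertex → Set
    p ⇒ q = ∃[ r ] Link ks₁ p r q

    _⇐_ : Vertex → Vertex → Set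
    p ⇐ q = ∃[ s ] Link ks₂ q s p

    V₁ V₂ : Vertex → Set
    V₁ = Visits ks₁
    V₂ = Visits ks₂

    closes : ∀ {v es} → Trail v v es → ¬ (es ↭ E₁ ++ E₂)
    closes c σ = no-tour (reorder (↭-trans σ total) c)

    meet : ∀ {v} → V₁ v → ¬ V₂ v
    meet v₁ v₂ = closes (visited P₁ v₁ ⟫ visited P₂ v₂) ↭-refl

    apart : ∀ {u v} → V₁ u → V₂ v → u ≢ v
    apart u₁ v₂ refl = meet u₁ v₂

    -- The detour from `p` to `q` and the one from `q` to `p` close into a tour.
    clash : ∀ {p q} → p ⇒ q → ¬ p ⇐ q
    clash (_ , l) (_ , l′) = closes (detour P₁ l ⟫ detour P₂ l′) ↭-refl

    near₁ : ∀ {p r t} → Link ks₁ p r t → V₁ p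
    near₁ = link-visits

    far₁ : ∀ {p r t} → Link ks₁ p r t → V₁ r
    far₁ l = link-visits (swapˡ l)

    near₂ : ∀ {p r t} → Link ks₂ p r t → V₂ p
    near₂ = link-visits

    far₂ : ∀ {p r t} → Link ks₂ p r t → V₂ r
    far₂ l = link-visits (swapˡ l)

    distinct : ∀ {ks p r t ks′ p′ r′ t′} (l : Link ks p r t) (l′ : Link ks′ p′ r′ t′) →
               t ≢ t′ → on l ≢ on l′
    distinct l l′ t≢t′ e = t≢t′ (same-third l l′ e)

    covered : ∀ x y → x ≢ y → Covers ks₁ x y ⊎ Covers ks₂ x y
    covered x y x≢y with covers x y x≢y
    ... | e , x∈ , y∈ with ∈-++⁻ E₁ (∈-resp-↭ (↭-sym total) (complete e))
    ...   | inj₁ e∈ = inj₁ (edge-covers e∈ x∈ y∈ x≢y)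
    ...   | inj₂ e∈ = inj₂ (edge-covers e∈ x∈ y∈ x≢y)

    -- The covering edge belongs to one trail, whose arcs never end on the other; so it skips the
    -- foreign vertex.
    orientation : ∀ {p q} → V₁ p → V₂ q → p ⇒ q ⊎ p ⇐ q
    orientation {p} {q} p₁ q₂ with covered p q (apart p₁ q₂)
    ... | inj₁ (both l)  = contradiction q₂ (meet (far₁ l))
    ... | inj₁ (left l)  = inj₁ (_ , l)
    ... | inj₁ (right l) = contradiction q₂ (meet (near₁ l))
    ... | inj₂ (both l)  = contradiction (near₂ l) (meet p₁)
    ... | inj₂ (left l)  = contradiction (near₂ l) (meet p₁)
    ... | inj₂ (right l) = inj₂ (_ , l)

    covered₁ : ∀ {x y} → x ≢ y → V₁ x → V₁ y → Covers ks₁ x y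
    covered₁ x≢y x₁ y₁ with covered _ _ x≢y
    ... | inj₁ c = c
    ... | inj₂ (both l)  = contradiction (near₂ l) (meet x₁)
    ... | inj₂ (left l)  = contradiction (near₂ l) (meet x₁)
    ... | inj₂ (right l) = contradiction (near₂ l) (meet y₁)

    covered₂ : ∀ {x y} → x ≢ y → V₂ x → V₂ y → Covers ks₂ x y
    covered₂ x≢y x₂ y₂ with covered _ _ x≢y
    ... | inj₂ c = c
    ... | inj₁ (both l)  = contradiction x₂ (meet (near₁ l))
    ... | inj₁ (left l)  = contradiction x₂ (meet (near₁ l))
    ... | inj₁ (right l) = contradiction y₂ (meet (near₁ l))

    -- `reroute` yields a tour, or else leaves at `p` a closed trail shorter than `ks₁`, against
    -- minimality.
    fork : ∀ {p r r′ α β} (l : Link ks₁ p r α) (l′ : Link ks₁ p r′ β) → on l ≢ on l′ → ¬ Trail α β E₂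
    fork l l′ l≢l′ ρ with reroute P₁ l l′ l≢l′ ρ
    ... | inj₁ (_ , c) = closes c ↭-refl
    ... | inj₂ (_ , A , B , a , b , σ , b<) = minimal b a (↭-trans (++-comm B A) (↭-trans σ total)) b<

    -- Minimality bounds the first trail only, so here the directions must agree for `reroute` to
    -- give a single closed trail.
    fork₂ : ∀ {q s s′ α β} (l : Link ks₂ q s α) (l′ : Link ks₂ q s′ β) → on l ≢ on l′ →
            leaves l ≡ leaves l′ → ¬ Trail α β E₁
    fork₂ l l′ l≢l′ same ρ with reroute P₂ l l′ l≢l′ ρ
    ... | inj₁ (_ , c) = closes c (++-comm E₂ E₁)
    ... | inj₂ (opposite , _) = opposite same

    -- `l` moves an end from `p` to `α`, `l′` moves one from `t` to `p`, and `ρ` restores the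
    -- degrees at `α` and `t`. Opposite directions give a tour. Equal ones split off a closed trail
    -- that lost two arcs and regained one, hence is shorter than `ks₁`.
    bridge : ∀ {p r t u α} (l : Link ks₁ p r α) (l′ : Link ks₁ t u p) → ¬ Trail α t E₂
    bridge l l′ ρ with cut-links P₁ l l′ (distinct l l′ (t≢p l))
    ... | A , B , σ , inj₁ (_ , a , b) =
      minimal (b ⟫ hop (t∈ l′) (r∈ l′) (t≢r l′))
        (hop (r∈ l) (t∈ l) (≢-sym (t≢r l)) ⟫ ρ ⟫ flipped a)
        (↭-trans (↭-trans
          (solve 5 (λ e f a b r → (b ⊕ f) ⊕ (e ⊕ r ⊕ a) ⊜ (e ⊕ f ⊕ a ⊕ b) ⊕ r) ↭-refl
            [ via (on l) ] [ via (on l′) ] A B E₂)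
          (++⁺ʳ E₂ σ)) total)
        shorter
      where
      shorter : length (B ++ [ via (on l′) ]) < length ks₁
      shorter = begin-strict
        length (B ++ [ via (on l′) ])  ≡⟨ length-++ B ⟩
        length B + 1                   ≡⟨ ℕₚ.+-comm (length B) 1 ⟩
        suc (length B)                 ≤⟨ s≤s (ℕₚ.m≤n+m (length B) (length A)) ⟩
        suc (length A + length B)      ≡⟨ cong suc (length-++ A) ⟨
        suc (length (A ++ B))          <⟨ ℕₚ.n<1+n _ ⟩
        suc (suc (length (A ++ B)))    ≡⟨ ↭-length σ ⟩
        length E₁                      ≡⟨ length-map via ks₁ ⟩
        length ks₁                     ∎
        where open ℕₚ.≤-Reasoning
    ... | A , B , σ , inj₂ (_ , a , b) =
      closes (hop (r∈ l) (t∈ l) (≢-sym (t≢r l)) ⟫ ρ ⟫ b ⟫ hop (t∈ l′) (r∈ l′) (t≢r l′) ⟫ flipped a)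
        (↭-trans
          (solve 5 (λ e f a b r → e ⊕ r ⊕ b ⊕ f ⊕ a ⊜ (e ⊕ f ⊕ a ⊕ b) ⊕ r) ↭-refl
            [ via (on l) ] [ via (on l′) ] A B E₂)
          (++⁺ʳ E₂ σ))

    -- The second trail, rerouted from `q` to `t`, feeds `fork` or `bridge`. So an edge of the first
    -- trail containing `p` and `t` must be crossed between them.
    relay : ∀ {p q t} → p ⇒ q → t ⇐ q → ¬ (∃[ u ] Link ks₁ p u t ⊎ ∃[ u ] Link ks₁ t u p)
    relay (_ , l) (_ , g) (inj₁ (_ , h)) = fork l h (distinct l h (≢-sym (t≢p g))) (detour P₂ g)
    relay (_ , l) (_ , g) (inj₂ (_ , h)) = bridge l h (detour P₂ g)

    -- Whichever way g and h are traversed, one of the two ends of g can be handed over to p.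
    hand-over : ∀ {p r r′ q q′ t s} (l : Link ks₁ p r q) (l′ : Link ks₁ p r′ q′) →
                (g : Link ks₂ q q′ t) (h : Link ks₂ t s p) → ⊥
    hand-over l l′ g h with cut-links P₂ g h (distinct g h (≢-sym (t≢p h)))
    ... | A , B , σ , inj₁ (_ , a , b) =
      closes (detour P₁ l′ ⟫ a ⟫ hop (t∈ g) (p∈ g) (t≢p g) ⟫ flipped b ⟫ hop (r∈ h) (t∈ h) (≢-sym (t≢r h)))
        (↭-trans
          (solve 5 (λ e f a b r → r ⊕ a ⊕ e ⊕ b ⊕ f ⊜ r ⊕ e ⊕ f ⊕ a ⊕ b) ↭-refl
            [ via (on g) ] [ via (on h) ] A B E₁)
          (++⁺ˡ E₁ σ))
    ... | A , B , σ , inj₂ (_ , a , b) =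
      closes (detour P₁ l ⟫ flipped b ⟫ hop (t∈ g) (r∈ g) (t≢r g) ⟫ a ⟫ hop (r∈ h) (t∈ h) (≢-sym (t≢r h)))
        (↭-trans
          (solve 5 (λ e f a b r → r ⊕ b ⊕ e ⊕ a ⊕ f ⊜ r ⊕ e ⊕ f ⊕ a ⊕ b) ↭-refl
            [ via (on g) ] [ via (on h) ] A B E₁)
          (++⁺ˡ E₁ σ))

    -- The four links form an alternating square p q t q′ (or p u t q′); the orientation of g
    -- relative to h decides which of q, u to use.
    square : ∀ {p q u t q′ r r′ r″ s} (l : Link ks₁ p r q) (l′ : Link ks₁ p r′ u) →
             (g : Link ks₂ q u t) (f : Link ks₁ t r″ q′) (h : Link ks₂ q′ s p) →
             q ≢ q′ → u ≢ q′ → t ≢ p → ⊥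
    square l l′ g f h q≢q′ u≢q′ ≢p with cut-links P₂ g h (distinct g h ≢p)
    ... | A , B , σ , inj₁ (_ , a , b) with cut-links P₁ l f (distinct l f q≢q′)
    ...   | C , D , τ , inj₁ (_ , c , d) =
      closes (hop (t∈ l) (r∈ l) (t≢r l) ⟫ c ⟫ hop (t∈ g) (r∈ g) (t≢r g) ⟫ a
                ⟫ hop (t∈ f) (r∈ f) (t≢r f) ⟫ d ⟫ hop (t∈ h) (r∈ h) (t≢r h) ⟫ b)
        (↭-trans
          (solve 8 (λ l f g h a b c d → l ⊕ c ⊕ g ⊕ a ⊕ f ⊕ d ⊕ h ⊕ b ⊜ (l ⊕ f ⊕ c ⊕ d) ⊕ g ⊕ h ⊕ a ⊕ b)
            ↭-refl [ via (on l) ] [ via (on f) ] [ via (on g) ] [ via (on h) ] A B C D)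
          (++⁺ τ σ))
    ...   | C , D , τ , inj₂ (_ , c , d) =
      closes (hop (t∈ l) (r∈ l) (t≢r l) ⟫ c ⟫ hop (r∈ f) (t∈ f) (≢-sym (t≢r f)) ⟫ flipped a
                ⟫ hop (r∈ g) (t∈ g) (≢-sym (t≢r g)) ⟫ d ⟫ hop (t∈ h) (r∈ h) (t≢r h) ⟫ b)
        (↭-trans
          (solve 8 (λ l f g h a b c d → l ⊕ c ⊕ f ⊕ a ⊕ g ⊕ d ⊕ h ⊕ b ⊜ (l ⊕ f ⊕ c ⊕ d) ⊕ g ⊕ h ⊕ a ⊕ b)
            ↭-refl [ via (on l) ] [ via (on f) ] [ via (on g) ] [ via (on h) ] A B C D)
          (++⁺ τ σ))
    square l l′ g f h q≢q′ u≢q′ ≢p | A , B , σ , inj₂ (_ , a , b) with cut-links P₁ l′ f (distinct l′ f u≢q′)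
    ... | C , D , τ , inj₁ (_ , c , d) =
      closes (hop (t∈ l′) (r∈ l′) (t≢r l′) ⟫ c ⟫ hop (t∈ g) (p∈ g) (t≢p g) ⟫ flipped b
                ⟫ hop (t∈ f) (r∈ f) (t≢r f) ⟫ d ⟫ hop (t∈ h) (r∈ h) (t≢r h) ⟫ flipped a)
        (↭-trans
          (solve 8 (λ l f g h a b c d → l ⊕ c ⊕ g ⊕ b ⊕ f ⊕ d ⊕ h ⊕ a ⊜ (l ⊕ f ⊕ c ⊕ d) ⊕ g ⊕ h ⊕ a ⊕ b)
            ↭-refl [ via (on l′) ] [ via (on f) ] [ via (on g) ] [ via (on h) ] A B C D)
          (++⁺ τ σ))
    ... | C , D , τ , inj₂ (_ , c , d) =
      closes (hop (t∈ l′) (r∈ l′) (t≢r l′) ⟫ c ⟫ hop (r∈ f) (t∈ f) (≢-sym (t≢r f)) ⟫ b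
                ⟫ hop (p∈ g) (t∈ g) (≢-sym (t≢p g)) ⟫ d ⟫ hop (t∈ h) (r∈ h) (t≢r h) ⟫ flipped a)
        (↭-trans
          (solve 8 (λ l f g h a b c d → l ⊕ c ⊕ f ⊕ b ⊕ g ⊕ d ⊕ h ⊕ a ⊜ (l ⊕ f ⊕ c ⊕ d) ⊕ g ⊕ h ⊕ a ⊕ b)
            ↭-refl [ via (on l′) ] [ via (on f) ] [ via (on g) ] [ via (on h) ] A B C D)
          (++⁺ τ σ))

    -- Rival trails with a dominated vertex.

    module Dominated {p₀ q₀ : Vertex} (q₀∈V₂ : V₂ q₀) (p₀⇒q₀ : p₀ ⇒ q₀) where

      -- A vertex on neither trail is skipped both at `p₀` and at `q₀`; then `fork` applies at `p₀`,
      -- with the second trail rerouted from `q₀` to `w`.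
      spanned : ∀ w → V₁ w ⊎ V₂ w
      spanned w with visits? ks₁ w | visits? ks₂ w
      ... | yes w₁ | _ = inj₁ w₁
      ... | no _ | yes w₂ = inj₂ w₂
      ... | no w∉₁ | no w∉₂ with covered p₀ w (λ { refl → w∉₁ (near₁ (proj₂ p₀⇒q₀)) })
      ...   | inj₁ (both l)  = contradiction (far₁ l) w∉₁
      ...   | inj₁ (right l) = contradiction (near₁ l) w∉₁
      ...   | inj₂ (both l)  = contradiction (far₂ l) w∉₂
      ...   | inj₂ (right l) = contradiction (near₂ l) w∉₂
      ...   | inj₂ (left l)  = contradiction (near₂ l) (meet (near₁ (proj₂ p₀⇒q₀)))
      ...   | inj₁ (left l) with covered q₀ w (λ { refl → w∉₂ q₀∈V₂ })
      ...     | inj₂ (both g)  = contradiction (far₂ g) w∉₂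
      ...     | inj₂ (right g) = contradiction (near₂ g) w∉₂
      ...     | inj₁ (both g)  = contradiction (far₁ g) w∉₁
      ...     | inj₁ (right g) = contradiction (near₁ g) w∉₁
      ...     | inj₁ (left g)  = contradiction q₀∈V₂ (meet (near₁ g))
      ...     | inj₂ (left g)  =
        ⊥-elim (fork (proj₂ p₀⇒q₀) l (distinct (proj₂ p₀⇒q₀) l (≢-sym (t≢p g))) (detour P₂ g))

      -- `fork` forbids the covering edge to skip `q` or `q′`. If it skipped a vertex `t` of the
      -- second trail, `fork` would apply when `p ⇒ t` and `hand-over` when `p ⇐ t`.
      dominated-pair : ∀ {p r r′ q q′} → Link ks₁ p r q → Link ks₁ p r′ q′ → q ≢ q′ → V₂ q → V₂ q′ →
                       ∃[ t ] (V₁ t × Link ks₂ q q′ t)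
      dominated-pair l l′ q≢q′ q₂ q′₂ with covered₂ q≢q′ q₂ q′₂
      ... | left g  = ⊥-elim (fork l l′ (distinct l l′ q≢q′) (detour P₂ g))
      ... | right g = ⊥-elim (fork l l′ (distinct l l′ q≢q′) (flipped (detour P₂ g)))
      ... | both {t} g with spanned t
      ...   | inj₁ t₁ = t , t₁ , g
      ...   | inj₂ t₂ with orientation (near₁ l) t₂
      ...     | inj₁ (_ , l″) = ⊥-elim (fork l l″ (distinct l l″ (≢-sym (t≢p g))) (detour P₂ g))
      ...     | inj₂ (_ , h) = ⊥-elim (hand-over l l′ g h)

      -- The counterpart on the first trail: `relay` excludes a covering edge that skips `p`, `t` or
      -- another vertex of the first trail.
      separated-pair : ∀ {p q t} → p ⇒ q → t ⇐ q → V₁ t → ∃[ u ] (Link ks₁ p t u × V₂ u)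
      separated-pair pq@(_ , l) tq@(_ , g) t₁ with covered₁ (λ { refl → clash pq tq }) (near₁ l) t₁
      ... | left h  = ⊥-elim (relay pq tq (inj₁ (_ , h)))
      ... | right h = ⊥-elim (relay pq tq (inj₂ (_ , h)))
      ... | both {u} h with spanned u
      ...   | inj₂ u₂ = u , h , u₂
      ...   | inj₁ u₁ with orientation u₁ (near₂ g)
      ...     | inj₁ uq = ⊥-elim (relay uq tq (inj₂ (_ , swapˡ h)))
      ...     | inj₂ uq = ⊥-elim (relay pq uq (inj₁ (_ , h)))

      -- Together with `inner-down`: an arc of the first trail that skips a vertex of that trail has
      -- all three vertices dominating the same set.
      inner-up : ∀ {a b c q} → Link ks₁ a b c → V₂ q → c ⇒ q → a ⇒ q
      inner-up h q₂ cq with orientation (near₁ h) q₂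
      ... | inj₁ aq = aq
      ... | inj₂ aq = ⊥-elim (relay cq aq (inj₂ (_ , h)))

      inner-down : ∀ {a b c q} → Link ks₁ a b c → V₁ c → V₂ q → a ⇒ q → c ⇒ q
      inner-down h c₁ q₂ aq with orientation c₁ q₂
      ... | inj₁ cq = cq
      ... | inj₂ cq = ⊥-elim (relay aq cq (inj₁ (_ , h)))

      -- Z bounds the set dominated by p; the descent replaces p by a vertex dominating strictly less.
      unmixed-below : ∀ N Z → length Z ≤ N → ∀ {p q t} → (∀ {v} → V₂ v → p ⇒ v → v ∈ˡ Z) →
                      V₁ t → p ⇒ q → ¬ t ⇐ q
      unmixed-below zero [] _ below _ pq (_ , g) with below (near₂ g) pq
      ... | ()
      unmixed-below (suc N) Z Z≤ {p} {q} {t} below t₁ pq@(_ , l) tq@(_ , g₀)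
        with separated-pair pq tq t₁
      -- The first trail joins `p` to `t` skipping `u`, and the second joins `q` to `u` skipping
      -- `s`. The chain from `p` over `q` to `s` begins the square, and `s` is the next vertex of
      -- the descent.
      ... | u , pt , u₂ with dominated-pair l pt (λ { refl → clash (_ , swapˡ pt) tq }) (near₂ g₀) u₂
      ...   | s , s₁ , g with separated-pair pq (_ , g) s₁
      ...     | u′ , ps , u′₂ with other-link P₁ (swapˡ ps)
      ...       | x , y , h , ps≢h = finish (spanned y)
        where
        q₂ : V₂ q
        q₂ = near₂ g
        Z′ : List Vertex
        Z′ = filter (λ v → ¬? (v ≟ q)) Z
        Z′≤ : length Z′ ≤ N
        Z′≤ = ℕₚ.≤-pred (ℕₚ.≤-trans (filter-notAll (λ v → ¬? (v ≟ q)) Z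
                (lose (below q₂ pq) (λ q≢q → q≢q refl))) Z≤)
        -- By `square`, `s` dominates only what `p` dominates, and it does not dominate `q`, since
        -- `s ⇐ q`.
        below′ : ∀ {v} → V₂ v → s ⇒ v → v ∈ˡ Z′
        below′ {v} v₂ sv@(_ , f) with orientation (near₁ l) v₂
        ... | inj₁ pv = ∈-filter⁺ (λ v → ¬? (v ≟ q)) (below v₂ pv) (λ { refl → clash sv (_ , g) })
        ... | inj₂ (_ , k) = ⊥-elim (square l pt g f k (λ { refl → clash sv (_ , g) })
                (λ { refl → clash sv (_ , swapˡ g) }) (λ { refl → clash pq (_ , g) }))
        -- A second vertex dominated by `s` would, by `dominated-pair`, make `u′` dominate a vertex
        -- of the first trail, which the induction forbids.
        only-u′ : ∀ {v} → V₂ v → s ⇒ v → v ≡ u′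
        only-u′ {v} v₂ (_ , f) with v ≟ u′
        ... | yes e = e
        ... | no v≢u′ with dominated-pair (swapˡ ps) f (≢-sym v≢u′) u′₂ v₂
        ...   | _ , w₁ , g′ = ⊥-elim (unmixed-below N Z′ Z′≤ below′ w₁ (_ , swapˡ ps) (_ , g′))
        -- If the other arc at `s` skips a vertex of the second trail, two arcs at `s` skip `u′`;
        -- otherwise the arcs from `p` to `s` and to `x` both do. Either way `fork` applies to the
        -- second trail closed at `u′`.
        finish : V₁ y ⊎ V₂ y → ⊥
        finish (inj₂ y₂) with only-u′ y₂ (_ , h)
        ... | refl = fork (swapˡ ps) h ps≢h (visited P₂ u′₂)
        finish (inj₁ y₁) = compare (separated-pair pq x⇐q (far₁ h))
          where
          x⇐q : x ⇐ q
          x⇐q with orientation (far₁ h) q₂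
          ... | inj₁ xq = ⊥-elim (clash (inner-up h q₂ (inner-down (swapˡ h) y₁ q₂ xq)) (_ , g))
          ... | inj₂ xq = xq
          compare : ∃[ u″ ] (Link ks₁ p x u″ × V₂ u″) → ⊥
          compare (u″ , px , u″₂)
            with only-u′ u″₂ (inner-up h u″₂ (inner-down (swapˡ h) y₁ u″₂ (_ , swapˡ px)))
          ... | refl = fork ps px (λ e → p≢r h (same-far-end ps px e)) (visited P₂ u″₂)

      unmixed : ∀ {p q t} → V₁ t → p ⇒ q → ¬ t ⇐ q
      unmixed = unmixed-below n (allFin n) (ℕₚ.≤-reflexive (length-tabulate {n = n} (λ i → i)))
        (λ {v} _ _ → ∈-allFin v)

      ⇒q₀ : ∀ {p} → V₁ p → p ⇒ q₀
      ⇒q₀ p₁ with orientation p₁ q₀∈V₂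
      ... | inj₁ pq = pq
      ... | inj₂ pq = ⊥-elim (unmixed p₁ p₀⇒q₀ pq)

      -- A further vertex dominated by `p` would, by `dominated-pair`, make `q₀` dominate a vertex
      -- of the first trail.
      ⇐others : ∀ {p q} → V₁ p → V₂ q → q ≢ q₀ → p ⇐ q
      ⇐others p₁ q₂ q≢q₀ with orientation p₁ q₂
      ... | inj₂ pq = pq
      ... | inj₁ (_ , l) with ⇒q₀ p₁
      ...   | pq₀@(_ , l₀) with dominated-pair l₀ l (≢-sym q≢q₀) q₀∈V₂ q₂
      ...     | _ , t₁ , g = ⊥-elim (unmixed t₁ pq₀ (_ , g))

      -- With opposite directions, the cyclic chain of changes from `q₀` to `q` to `p` to `q₀` gives
      -- a tour.
      balanced : ∀ {q u s p} → (g : Link ks₂ q₀ u q) (k : Link ks₂ q s p) → V₁ p → leaves g ≡ leaves k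
      balanced g k p₁ with ⇒q₀ p₁
      ... | _ , l with cut-links P₂ g k (distinct g k (≢-sym (t≢p k)))
      ...   | A , B , σ , inj₁ (same , _) = same
      ...   | A , B , σ , inj₂ (_ , a , b) = ⊥-elim (closes
        (hop (t∈ g) (r∈ g) (t≢r g) ⟫ a ⟫ hop (r∈ k) (t∈ k) (≢-sym (t≢r k)) ⟫ detour P₁ l ⟫ flipped b)
        (↭-trans
          (solve 5 (λ e f a b r → e ⊕ a ⊕ f ⊕ r ⊕ b ⊜ r ⊕ e ⊕ f ⊕ a ⊕ b) ↭-refl
            [ via (on g) ] [ via (on k) ] A B E₁)
          (++⁺ˡ E₁ σ)))

      impossible : ⊥
      impossible with other-link P₁ (proj₂ p₀⇒q₀)
      ... | x , y , h , l₀≢h with spanned y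
      ...   | inj₂ y₂ with y ≟ q₀
      ...     | yes refl = fork (proj₂ p₀⇒q₀) h l₀≢h (visited P₂ y₂)
      ...     | no y≢q₀ = clash (_ , h) (⇐others (near₁ h) y₂ y≢q₀)
      impossible | x , y , h , l₀≢h | inj₁ y₁ with visits-link q₀∈V₂
      ... | _ , t , g with spanned t
      ...   | inj₁ t₁ = unmixed t₁ p₀⇒q₀ (_ , g)
      -- The links at `t` that skip `p₀` and `y` both have the direction of `g`, so `fork₂` closes
      -- them up with the first trail rerouted from `p₀` to `y`.
      ...   | inj₂ t₂ with ⇐others (near₁ h) t₂ (t≢p g) | ⇐others y₁ t₂ (t≢p g)
      ...     | _ , k | _ , k′ =
        fork₂ k k′ (distinct k k′ (≢-sym (t≢p h)))
          (trans (sym (balanced g k (near₁ h))) (balanced g k′ y₁)) (detour P₁ h)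

    -- Rival trails without a dominated vertex.

    module Undominated (none : ∀ {p q} → V₂ q → ¬ p ⇒ q) {q : Vertex} (q∈V₂ : V₂ q) where

      link-from-q : ∀ {x} → ¬ V₂ x → ∃[ s ] Link ks₂ q s x
      link-from-q {x} x∉₂ with covered q x (λ { refl → x∉₂ q∈V₂ })
      ... | inj₁ (both l)  = contradiction q∈V₂ (meet (near₁ l))
      ... | inj₁ (left l)  = contradiction q∈V₂ (meet (near₁ l))
      ... | inj₁ (right l) = contradiction (_ , l) (none q∈V₂)
      ... | inj₂ (both l)  = contradiction (far₂ l) x∉₂
      ... | inj₂ (right l) = contradiction (near₂ l) x∉₂
      ... | inj₂ (left l)  = _ , l

      -- The direction in which the link from q omitting x is traversed; junk when x is visited by P₂.
      spin : Vertex → Bool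
      spin x with visits? ks₂ x
      ... | yes _ = true
      ... | no x∉₂ = leaves (proj₂ (link-from-q x∉₂))

      -- With equal directions, `fork₂` would hand the two links at `q` over to the ends of the
      -- rerouted first trail.
      spins-differ : ∀ {x y} → ¬ V₂ x → ¬ V₂ y → x ≢ y → Trail x y E₁ → spin x ≢ spin y
      spins-differ {x} {y} x∉₂ y∉₂ x≢y ρ same with visits? ks₂ x | visits? ks₂ y
      ... | yes x₂ | _ = x∉₂ x₂
      ... | no _ | yes y₂ = y∉₂ y₂
      ... | no x∉ | no y∉ = fork₂ l l′ (distinct l l′ x≢y) same ρ
        where
        l = proj₂ (link-from-q x∉)
        l′ = proj₂ (link-from-q y∉)

      ends-spin : ∀ {p r t} → Link ks₁ p r t → spin t ≢ spin p
      ends-spin l = spins-differ (λ t₂ → none t₂ (_ , l)) (meet (near₁ l)) (t≢p l) (flipped (detour P₁ l))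

      -- Both ends differ in spin from the skipped vertex, and there are only two spins.
      same-spin : ∀ {p r t} → Link ks₁ p r t → spin p ≡ spin r
      same-spin l = trans (¬-not (≢-sym (ends-spin l))) (sym (¬-not (≢-sym (ends-spin (swapˡ l)))))

      constant : ∀ {a b ks} → Path a b ks → (∀ {k} → k ∈ˡ ks → k ∈ˡ ks₁) →
                 ∀ {k} → k ∈ˡ ks → spin (src k) ≡ spin a
      constant (step k refl _) _ (here refl) = refl
      constant (step k refl p) ⊆ks₁ (there k∈) with arc-from k (⊆ks₁ (here refl)) refl
      ... | _ , l , _ = trans (constant p (⊆ks₁ ∘ there) k∈) (sym (same-spin l))

      all-spin : ∀ {v} → V₁ v → spin v ≡ spin x₁
      all-spin vis with find vis
      ... | k , k∈ , inj₁ refl = constant P₁ (λ k∈ → k∈) k∈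
      ... | k , k∈ , inj₂ refl with arc-to k k∈ refl
      ...   | _ , l , _ = trans (same-spin l) (constant P₁ (λ k∈ → k∈) k∈)

      -- Spin is constant on the first trail, and the skipped vertex has the other spin.
      third-unvisited : ∀ {p r t} → Link ks₁ p r t → ¬ V₁ t × ¬ V₂ t
      third-unvisited l =
        (λ t₁ → ends-spin l (trans (all-spin t₁) (sym (all-spin (near₁ l))))) ,
        (λ t₂ → none t₂ (_ , l))

      -- An edge containing two unvisited vertices could skip only one of them.
      unvisited-unique : ∀ {s t} → ¬ V₁ s × ¬ V₂ s → ¬ V₁ t × ¬ V₂ t → s ≡ t
      unvisited-unique {s} {t} (s∉₁ , s∉₂) (t∉₁ , t∉₂) with s ≟ t
      ... | yes e = e
      ... | no s≢t with covered s t s≢t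
      ...   | inj₁ (both l)  = contradiction (near₁ l) s∉₁
      ...   | inj₁ (left l)  = contradiction (near₁ l) s∉₁
      ...   | inj₁ (right l) = contradiction (near₁ l) t∉₁
      ...   | inj₂ (both l)  = contradiction (near₂ l) s∉₂
      ...   | inj₂ (left l)  = contradiction (near₂ l) s∉₂
      ...   | inj₂ (right l) = contradiction (near₂ l) t∉₂

      impossible : ∀ {ks} → Path x₁ x₁ ks → ks ≡ ks₁ → ⊥
      impossible [] refl = closes (trail P₂) ↭-refl
      impossible (step k refl []) refl = src≢tgt k refl
      impossible (step k refl (step k′ {rest} e p)) refl with arc-from k (here refl) refl | arc-from k′ (there (here refl)) e
      ... | w , l , refl | w′ , l′ , refl with unvisited-unique (third-unvisited l) (third-unvisited l′)
      ...   | refl = spins-differ (meet (near₁ l)) (meet (far₁ l)) (p≢r l) swerve (same-spin l)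
        where
        -- Backwards along the rest to the far end of `k′`, then through the common skipped vertex
        -- by way of `k′` and `k`. The ends of `k` have equal spin, so such a trail cannot exist.
        swerve : Trail (src k) (tgt k) E₁
        swerve = reorder
          (solve 3 (λ e f r → r ⊕ f ⊕ e ⊜ e ⊕ f ⊕ r) ↭-refl [ via k ] [ via k′ ] (edges rest))
          (flipped (trail p) ⟫ hop (r∈ l′) (t∈ l′) (≢-sym (t≢r l′)) ⟫ hop (t∈ l) (r∈ l) (t≢r l))

    contradictory : ⊥
    contradictory = clear P₂ refl
      where
      clear : ∀ {ks} → Path x₂ x₂ ks → ks ≡ ks₂ → ⊥
      clear [] refl = closes (trail P₁) (↭-reflexive (sym (++-identityʳ E₁)))
      clear (step k refl _) refl =
        Undominated.impossible (λ q₂ pq → Dominated.impossible q₂ pq) (here (inj₁ refl)) P₁ refl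

-- Reducing the number of closed trails.

module Merging {n : ℕ} {H : Hypergraph n} (cov : Covering3 H) where
  open Covering3 cov
  open Trails H
  open Links H uniform
  open Duel cov

  all : List Edge
  all = allFin (m H)

  module _ (no-tour : ∀ {v} → ¬ Trail v v all) where

    -- Induction on a bound for the length of the first trail supplies the minimality assumed in
    -- `Rivals`.
    no-pair : ∀ N {a b A B} → Trail a a A → Trail b b B → A ++ B ↭ all → ¬ length A ≤ N
    no-pair N {A = A} (ks , P , σ) (ls , Q , τ) total A≤N =
      Rivals.contradictory P Q all ∈-allFin (↭-trans (++⁺ σ τ) total) no-tour (below N A≤N)
      where
      ks≡A : length ks ≡ length A
      ks≡A = trans (sym (length-map via ks)) (↭-length σ)
      below : ∀ N → length A ≤ N → ∀ {a b A′ B′} → Trail a a A′ → Trail b b B′ → A′ ++ B′ ↭ all →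
              ¬ length A′ < length ks
      below N A≤N c d ρ A′<ks with N | ℕₚ.<-≤-trans A′<ks (ℕₚ.≤-trans (ℕₚ.≤-reflexive ks≡A) A≤N)
      ... | suc N′ | s≤s A′≤N′ = no-pair N′ c d ρ A′≤N′

    NoFamily : ℕ → Set
    NoFamily N = ∀ css → length css ≤ N → All ClosedTrail css → ¬ (concat css ↭ all)

    -- A trail of `rest` containing the covering edge would visit `p` or `q` and could be absorbed
    -- there. On `P` or `Q` the edge must skip the other base vertex, or the two would merge. Each
    -- exception would leave fewer trails.
    orient : ∀ {p q ks ls rest} → NoFamily (suc (length rest)) → Path p p ks → Path q q ls →
             All ClosedTrail rest → edges ks ++ edges ls ++ concat rest ↭ all →
             ∃[ r ] Link ks p r q ⊎ ∃[ s ] Link ls q s p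
    orient {p} {q} {ks} {ls} {rest} none P Q closed total = locate (∈-++⁻ (edges ks) (∈-resp-↭ (↭-sym total) (∈-allFin e)))
      where
      separate : ∀ {v} → Trail v v (edges ks) → ¬ Trail v v (edges ls)
      separate c d = none (_ ∷ rest) ℕₚ.≤-refl ((_ , c ⟫ d) ∷ closed)
        (↭-trans (↭-reflexive (++-assoc (edges ks) _ _)) total)
      p≢q : p ≢ q
      p≢q refl = separate (trail P) (trail Q)
      e : Edge
      e = proj₁ (covers p q p≢q)
      p∈e = proj₁ (proj₂ (covers p q p≢q))
      q∈e = proj₂ (proj₂ (covers p q p≢q))
      in-rest : ∀ {xs} → xs ∈ˡ rest → e ∈ˡ xs → ⊥
      in-rest {xs} xs∈ e∈ with ∈-∃++ xs∈
      ... | R₁ , R₂ , refl with ++⁻ R₁ closed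
      ...   | closed₁ , (_ , (js , J , σ)) ∷ closed₂ =
        touches (edge-covers (∈-resp-↭ (↭-sym σ) e∈) p∈e q∈e p≢q)
        where
        shorter : suc (length (R₁ ++ R₂)) ≤ length (R₁ ++ _ ∷ R₂)
        shorter = ℕₚ.≤-reflexive (trans (cong suc (length-++ R₁))
          (trans (sym (ℕₚ.+-suc (length R₁) (length R₂))) (sym (length-++ R₁))))
        closed′ = ++⁺ᴬ closed₁ closed₂
        gather : ∀ A B → A ++ B ++ concat rest ↭ all → (A ++ edges js) ++ B ++ concat (R₁ ++ R₂) ↭ all
        gather A B τ =
          ↭-trans (++⁺ˡ (A ++ edges js) (++⁺ˡ B (↭-reflexive (sym (concat-++ R₁ R₂)))))
          (↭-trans
            (solve 5 (λ a b c d j → (a ⊕ j) ⊕ b ⊕ c ⊕ d ⊜ a ⊕ b ⊕ c ⊕ j ⊕ d) ↭-refl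
              A B (concat R₁) (concat R₂) (edges js))
            (↭-trans (++⁺ˡ A (++⁺ˡ B (↭-trans (++⁺ˡ (concat R₁) (++⁺ʳ (concat R₂) σ))
              (↭-reflexive (concat-++ R₁ (xs ∷ R₂)))))) τ))
        at-p : Trail p p (edges js) → ⊥
        at-p c = none ((edges ks ++ edges js) ∷ edges ls ∷ (R₁ ++ R₂)) (s≤s shorter)
          ((_ , trail P ⟫ c) ∷ (_ , trail Q) ∷ closed′) (gather (edges ks) (edges ls) total)
        at-q : Trail q q (edges js) → ⊥
        at-q c = none ((edges ls ++ edges js) ∷ edges ks ∷ (R₁ ++ R₂)) (s≤s shorter)
          ((_ , trail Q ⟫ c) ∷ (_ , trail P) ∷ closed′)
          (gather (edges ls) (edges ks) (↭-trans (shifts (edges ls) (edges ks)) total))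
        touches : Covers js p q → ⊥
        touches (both l)  = at-p (at-start J l)
        touches (left l)  = at-p (at-start J l)
        touches (right l) = at-q (at-start J l)
      locate : e ∈ˡ edges ks ⊎ e ∈ˡ edges ls ++ concat rest → _
      locate (inj₁ e∈) with edge-covers e∈ p∈e q∈e p≢q
      ... | both l  = contradiction (trail Q) (separate (at-start P (swapˡ l)))
      ... | left l  = inj₁ (_ , l)
      ... | right l = contradiction (trail Q) (separate (at-start P l))
      locate (inj₂ e∈) with ∈-++⁻ (edges ls) e∈
      ... | inj₂ e∈rest with ∈-concat⁻′ rest e∈rest
      ...   | xs , e∈xs , xs∈ = ⊥-elim (in-rest xs∈ e∈xs)
      locate (inj₂ e∈) | inj₁ e∈ls with edge-covers e∈ls p∈e q∈e p≢q
      ... | both l  = contradiction (at-start Q l) (separate (trail P))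
      ... | left l  = contradiction (at-start Q l) (separate (trail P))
      ... | right l = inj₂ (_ , l)

    module _ {x y z ks ls js rest} (none : NoFamily (2 + length rest))
             (P : Path x x ks) (Q : Path y y ls) (R : Path z z js) (closed : All ClosedTrail rest) where

      cyclic : ∀ {r s t} → Link ks x r y → Link ls y s z → Link js z t x →
               ¬ (edges ks ++ edges ls ++ edges js ++ concat rest ↭ all)
      cyclic l l′ l″ total = none (_ ∷ rest) (ℕₚ.n≤1+n _)
        ((x , detour P l ⟫ detour Q l′ ⟫ detour R l″) ∷ closed)
        (↭-trans (solve 4 (λ a b c d → (a ⊕ b ⊕ c) ⊕ d ⊜ a ⊕ b ⊕ c ⊕ d) ↭-refl
          (edges ks) (edges ls) (edges js) (concat rest)) total)

      -- The two arcs at `x` are handed over to `z` and `y`, which the detour of `Q` joins. The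
      -- closed trail through `z` absorbs `R`, and at most one further piece remains, at `x`.
      transitive : ∀ {r r′ s} → Link ks x r y → Link ks x r′ z → Link ls y s z →
                   ¬ (edges ks ++ edges ls ++ edges js ++ concat rest ↭ all)
      transitive l l′ g total
        with reroute P l′ l (λ e → t≢p g (same-third l′ l e)) (flipped (detour Q g))
      ... | inj₁ (_ , c) = none (_ ∷ rest) (ℕₚ.n≤1+n _) ((z , c ⟫ trail R) ∷ closed)
        (↭-trans (solve 4 (λ a b c d → ((a ⊕ b) ⊕ c) ⊕ d ⊜ a ⊕ b ⊕ c ⊕ d) ↭-refl
          (edges ks) (edges ls) (edges js) (concat rest)) total)
      ... | inj₂ (_ , A , B , a , b , σ , _) = none (_ ∷ _ ∷ rest) ℕₚ.≤-refl ((z , a ⟫ trail R) ∷ (x , b) ∷ closed)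
        (↭-trans (solve 4 (λ a b c d → (a ⊕ c) ⊕ b ⊕ d ⊜ (a ⊕ b) ⊕ c ⊕ d) ↭-refl
          A B (edges js) (concat rest))
          (↭-trans (++⁺ʳ _ σ) (↭-trans (↭-reflexive (++-assoc (edges ks) _ _)) total)))

    no-family : ∀ N → NoFamily N
    no-family _ [] _ _ σ = contradiction (trans (↭-length σ) (length-tabulate {n = m H} (λ i → i)))
      (ℕₚ.<⇒≢ nonempty)
    no-family _ (A ∷ []) _ ((_ , c) ∷ []) σ = no-tour (reorder (↭-trans (↭-reflexive (sym (++-identityʳ A))) σ) c)
    no-family _ (A ∷ B ∷ []) _ ((_ , c) ∷ (_ , d) ∷ []) σ =
      no-pair (length A) c d (↭-trans (++⁺ˡ A (↭-reflexive (sym (++-identityʳ B)))) σ) ℕₚ.≤-refl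
    no-family (suc N) (A ∷ B ∷ C ∷ rest) (s≤s ≤N)
      ((x , ks , P , σ₁) ∷ (y , ls , Q , σ₂) ∷ (z , js , R , σ₃) ∷ closed) σ =
      compare (orient none P Q ((_ , trail R) ∷ closed) xyz)
              (orient none Q R ((_ , trail P) ∷ closed) yzx)
              (orient none P R ((_ , trail Q) ∷ closed) xzy)
      where
      none : NoFamily (2 + length rest)
      none css le = no-family N css (ℕₚ.≤-trans le ≤N)
      a = edges ks
      b = edges ls
      c = edges js
      d = concat rest
      xyz : a ++ b ++ c ++ d ↭ all
      xyz = ↭-trans (++⁺ σ₁ (++⁺ σ₂ (++⁺ σ₃ ↭-refl))) σ
      yzx : b ++ c ++ a ++ d ↭ all
      yzx = ↭-trans (solve 4 (λ a b c d → b ⊕ c ⊕ a ⊕ d ⊜ a ⊕ b ⊕ c ⊕ d) ↭-refl a b c d) xyz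
      zxy : c ++ a ++ b ++ d ↭ all
      zxy = ↭-trans (solve 4 (λ a b c d → c ⊕ a ⊕ b ⊕ d ⊜ a ⊕ b ⊕ c ⊕ d) ↭-refl a b c d) xyz
      xzy : a ++ c ++ b ++ d ↭ all
      xzy = ↭-trans (solve 4 (λ a b c d → a ⊕ c ⊕ b ⊕ d ⊜ a ⊕ b ⊕ c ⊕ d) ↭-refl a b c d) xyz
      yxz : b ++ a ++ c ++ d ↭ all
      yxz = ↭-trans (solve 4 (λ a b c d → b ⊕ a ⊕ c ⊕ d ⊜ a ⊕ b ⊕ c ⊕ d) ↭-refl a b c d) xyz
      zyx : c ++ b ++ a ++ d ↭ all
      zyx = ↭-trans (solve 4 (λ a b c d → c ⊕ b ⊕ a ⊕ d ⊜ a ⊕ b ⊕ c ⊕ d) ↭-refl a b c d) xyz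
      compare : ∃[ r ] Link ks x r y ⊎ ∃[ r ] Link ls y r x →
                ∃[ r ] Link ls y r z ⊎ ∃[ r ] Link js z r y →
                ∃[ r ] Link ks x r z ⊎ ∃[ r ] Link js z r x → ⊥
      compare (inj₁ (_ , xy)) (inj₁ (_ , yz)) (inj₁ (_ , xz)) = transitive none P Q R closed xy xz yz xyz
      compare (inj₁ (_ , xy)) (inj₁ (_ , yz)) (inj₂ (_ , zx)) = cyclic none P Q R closed xy yz zx xyz
      compare (inj₁ (_ , xy)) (inj₂ (_ , zy)) (inj₁ (_ , xz)) = transitive none P R Q closed xz xy zy xzy
      compare (inj₁ (_ , xy)) (inj₂ (_ , zy)) (inj₂ (_ , zx)) = transitive none R P Q closed zx zy xy zxy
      compare (inj₂ (_ , yx)) (inj₁ (_ , yz)) (inj₁ (_ , xz)) = transitive none Q P R closed yx yz xz yxz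
      compare (inj₂ (_ , yx)) (inj₁ (_ , yz)) (inj₂ (_ , zx)) = transitive none Q R P closed yz yx zx yzx
      compare (inj₂ (_ , yx)) (inj₂ (_ , zy)) (inj₁ (_ , xz)) = cyclic none P R Q closed xz zy yx xzy
      compare (inj₂ (_ , yx)) (inj₂ (_ , zy)) (inj₂ (_ , zx)) = transitive none R Q P closed zy zx yx zyx

-- Parity correction along a tree, and gluing into closed trails.

module Decomposing {n : ℕ} {H : Hypergraph n} (cov : Covering3 H) where
  open Covering3 cov
  open Trails H

  complement : ∀ {A : Set} {xs ys : List A} → Unique xs → (∀ {x} → x ∈ˡ xs → x ∈ˡ ys) →
               ∃[ zs ] xs ++ zs ↭ ys
  complement {ys = ys} [] _ = ys , ↭-refl
  complement {xs = x ∷ xs} (x∉ ∷ unique) xs⊆ys with ∈-∃++ (xs⊆ys (here refl))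
  ... | as , bs , refl with complement unique xs⊆
    where
    xs⊆ : ∀ {y} → y ∈ˡ xs → y ∈ˡ as ++ bs
    xs⊆ y∈ with ∈-resp-↭ (shift x as bs) (xs⊆ys (there y∈))
    ... | here refl = contradiction refl (All.lookup x∉ y∈)
    ... | there y∈′ = y∈′
  ...   | zs , σ = zs , ↭-trans (prep x σ) (↭-sym (shift x as bs))

  unique-bound : ∀ {A : Set} {xs ys : List A} → Unique xs → (∀ {x} → x ∈ˡ xs → x ∈ˡ ys) →
                 length xs ≤ length ys
  unique-bound {xs = xs} unique xs⊆ys with complement unique xs⊆ys
  ... | zs , σ = ℕₚ.≤-trans (ℕₚ.m≤m+n _ (length zs))
    (ℕₚ.≤-reflexive (trans (sym (length-++ xs)) (↭-length σ)))

  insert : ∀ {A : Set} {x : A} {xs} → x ∉ˡ xs → Unique xs → Unique (x ∷ xs)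
  insert x∉ unique = All.tabulate (λ { y∈ refl → x∉ y∈ }) ∷ unique

  record Triple (a b : Vertex) : Set where
    field
      e    : Edge
      z    : Vertex
      a≢b  : a ≢ b
      a∈   : a ∈ edge H e
      b∈   : b ∈ edge H e
      z∈   : z ∈ edge H e
      z≢a  : z ≢ a
      z≢b  : z ≢ b

    within : ∀ {x} → x ∈ edge H e → x ≡ a ⊎ x ≡ b ⊎ x ≡ z
    within = only-three (uniform e) a∈ b∈ z∈ a≢b (≢-sym z≢a) (≢-sym z≢b)
  open Triple

  triple : ∀ {a b} → a ≢ b → Triple a b
  triple {a} {b} a≢b with covers a b a≢b
  ... | e , a∈ , b∈ with third (uniform e) a∈ b∈ a≢b
  ...   | z , z∈ , z≢a , z≢b = record
    { e = e ; z = z ; a≢b = a≢b ; a∈ = a∈ ; b∈ = b∈ ; z∈ = z∈ ; z≢a = z≢a ; z≢b = z≢b }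

  -- The edges F connect the vertices M as a tree when each Triple x y is read as an edge xy.
  data Grow : List Vertex → List Edge → Set where
    seed   : ∀ v → Grow [ v ] []
    sprout : ∀ {M F x y} → Grow M F → (τ : Triple x y) → x ∈ˡ M → y ∉ˡ M → e τ ∉ˡ F →
             Grow (y ∷ M) (e τ ∷ F)

  grow-uniqueᵛ : ∀ {M F} → Grow M F → Unique M
  grow-uniqueᵛ (seed v) = [] ∷ []
  grow-uniqueᵛ (sprout g _ _ y∉ _) = insert y∉ (grow-uniqueᵛ g)

  grow-uniqueᵉ : ∀ {M F} → Grow M F → Unique F
  grow-uniqueᵉ (seed v) = []
  grow-uniqueᵉ (sprout g _ _ _ e∉) = insert e∉ (grow-uniqueᵉ g)

  Strand : Set
  Strand = ∃₂ λ a b → ∃[ es ] Trail a b es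

  load : List Strand → List Edge
  load [] = []
  load ((_ , _ , es , _) ∷ S) = es ++ load S

  δ : Vertex → Vertex → Bool
  δ u v = does (u ≟ v)

  δ-≡ : ∀ v → δ v v ≡ true
  δ-≡ v = dec-true (v ≟ v) refl

  δ-≢ : ∀ {u v} → u ≢ v → δ u v ≡ false
  δ-≢ {u} {v} = dec-false (u ≟ v)

  -- Counting ends modulo 2 gives the degree parity, as passing through a vertex contributes evenly.
  odd : Vertex → List Strand → Bool
  odd v [] = false
  odd v ((a , b , _) ∷ S) = δ v a xor (δ v b xor odd v S)

  -- The parity already determined by tree edges still to be placed: each will have one end at its
  -- third vertex.
  thirds : ∀ {M F} → Grow M F → Vertex → Bool
  thirds (seed _) v = false
  thirds (sprout g τ _ _ _) v = δ v (z τ) xor thirds g v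

  EvenBut : Vertex → List Strand → Set
  EvenBut root S = ∀ {v} → v ≢ root → odd v S ≡ false

  -- Every edge of the tree is used through its third vertex; its other end, x or y, is chosen
  -- leaf by leaf so as to fix the parity at y.
  settle : ∀ {M F} (g : Grow M F) (S : List Strand) →
           (∀ {v} → v ∉ˡ M → odd v S xor thirds g v ≡ false) →
           ∃₂ λ root S′ → EvenBut root S′ × load S′ ↭ F ++ load S
  settle (seed v) S even =
    v , S , (λ u≢v → trans (sym (xor-identityʳ _)) (even λ { (here u≡v) → u≢v u≡v })) , ↭-refl
  settle {F = _ ∷ F} (sprout {M} {x = x} {y} g τ x∈ y∉ _) S even = choose (odd y S xor thirds g y) refl
    where
    x≢y : x ≢ y
    x≢y refl = y∉ x∈
    outside : ∀ w {v} → v ∉ˡ y ∷ M → v ≢ w →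
              (δ v (z τ) xor (δ v w xor odd v S)) xor thirds g v ≡ false
    outside w {v} v∉ v≢w = begin
      (δ v (z τ) xor (δ v w xor odd v S)) xor thirds g v
        ≡⟨ cong (λ b → (δ v (z τ) xor (b xor odd v S)) xor thirds g v) (δ-≢ v≢w) ⟩
      (δ v (z τ) xor odd v S) xor thirds g v
        ≡⟨ cong (_xor thirds g v) (xor-comm (δ v (z τ)) (odd v S)) ⟩
      (odd v S xor δ v (z τ)) xor thirds g v
        ≡⟨ xor-assoc (odd v S) _ _ ⟩
      odd v S xor (δ v (z τ) xor thirds g v)
        ≡⟨ even v∉ ⟩
      false ∎
      where open ≡-Reasoning
    at-y : ∀ w → δ y w ≡ odd y S xor thirds g y →
           (δ y (z τ) xor (δ y w xor odd y S)) xor thirds g y ≡ false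
    at-y w fits = begin
      (δ y (z τ) xor (δ y w xor odd y S)) xor thirds g y
        ≡⟨ cong (λ b → (b xor (δ y w xor odd y S)) xor thirds g y) (δ-≢ (≢-sym (z≢b τ))) ⟩
      (δ y w xor odd y S) xor thirds g y
        ≡⟨ xor-assoc (δ y w) _ _ ⟩
      δ y w xor (odd y S xor thirds g y)
        ≡⟨ cong (_xor (odd y S xor thirds g y)) fits ⟩
      (odd y S xor thirds g y) xor (odd y S xor thirds g y)
        ≡⟨ xor-same (odd y S xor thirds g y) ⟩
      false ∎
      where open ≡-Reasoning
    add : ∀ w → w ∈ edge H (e τ) → z τ ≢ w → (∀ {v} → v ∉ˡ y ∷ M → v ≢ w) →
          δ y w ≡ odd y S xor thirds g y →
          ∃₂ λ root S′ → EvenBut root S′ × load S′ ↭ (e τ ∷ F) ++ load S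
    add w w∈ t≢w v≢w fits with settle g ((z τ , w , _ , hop (z∈ τ) w∈ t≢w) ∷ S) even′
      where
      even′ : ∀ {v} → v ∉ˡ M → (δ v (z τ) xor (δ v w xor odd v S)) xor thirds g v ≡ false
      even′ {v} v∉ with v ≟ y
      ... | yes refl = at-y w fits
      ... | no v≢y = outside w v∉y∷M (v≢w v∉y∷M)
        where
        v∉y∷M : v ∉ˡ y ∷ M
        v∉y∷M (here v≡y) = v≢y v≡y
        v∉y∷M (there v∈) = v∉ v∈
    ... | root , S′ , evenBut , σ = root , S′ , evenBut , ↭-trans σ (shift (e τ) F (load S))
    -- As `y` is outside the remaining tree, later choices reach it only through `thirds g`. If the
    -- parity there is odd the new arc ends at `y`, otherwise at `x`, which is still in the tree.
    choose : ∀ b → odd y S xor thirds g y ≡ b → ∃₂ λ root S′ → EvenBut root S′ × load S′ ↭ (e τ ∷ F) ++ load S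
    choose true  eq = add y (b∈ τ) (z≢b τ) (λ { v∉ refl → v∉ (here refl) }) (trans (δ-≡ y) (sym eq))
    choose false eq = add x (a∈ τ) (z≢a τ) (λ { v∉ refl → v∉ (there x∈) }) (trans (δ-≢ (≢-sym x≢y)) (sym eq))

  xor-cancel : ∀ c d x → c xor (d xor (c xor x)) ≡ d xor x
  xor-cancel false d x = refl
  xor-cancel true false x = not-involutive x
  xor-cancel true true x = not-involutive (not x)

  extract : ∀ {c} S → odd c S ≡ true →
            ∃₂ λ c′ es → Trail c c′ es × ∃[ S′ ] (load S ↭ es ++ load S′ × length S ≡ suc (length S′) ×
              (∀ v → odd v S ≡ δ v c xor (δ v c′ xor odd v S′)))
  extract {c} ((a , b , es , r) ∷ S) o with c ≟ a | c ≟ b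
  ... | yes refl | _ = b , es , r , S , ↭-refl , refl , λ _ → refl
  ... | no _ | yes refl = a , es , flipped r , S , ↭-refl , refl , λ v → begin
    δ v a xor (δ v b xor odd v S)  ≡⟨ xor-assoc (δ v a) _ _ ⟨
    (δ v a xor δ v b) xor odd v S  ≡⟨ cong (_xor odd v S) (xor-comm (δ v a) (δ v b)) ⟩
    (δ v b xor δ v a) xor odd v S  ≡⟨ xor-assoc (δ v b) _ _ ⟩
    δ v b xor (δ v a xor odd v S)  ∎
    where open ≡-Reasoning
  ... | no _ | no _ with extract S o
  ...   | c′ , fs , r′ , S′ , σ , len , par =
    c′ , fs , r′ , (a , b , es , r) ∷ S′
    , ↭-trans (++⁺ˡ es σ) (shifts es fs) , cong suc len , λ v → begin
      δ v a xor (δ v b xor odd v S)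
        ≡⟨ cong (λ z → δ v a xor (δ v b xor z)) (par v) ⟩
      δ v a xor (δ v b xor (δ v c xor (δ v c′ xor odd v S′)))
        ≡⟨ rearrange (δ v a) (δ v b) (δ v c) (δ v c′) (odd v S′) ⟩
      δ v c xor (δ v c′ xor (δ v a xor (δ v b xor odd v S′))) ∎
    where
    open ≡-Reasoning
    open xor-∧-Solver using (_:+_; _:=_) renaming (solve to ring)
    rearrange = ring 5 (λ a b c d x → a :+ (b :+ (c :+ (d :+ x))) := c :+ (d :+ (a :+ (b :+ x)))) refl

  mutual
    -- A closed strand is set aside. An open one has an end other than the root, where evenness
    -- provides a second strand to glue on; both moves lower the number of strands.
    weave : ∀ N S {root} → length S ≤ N → EvenBut root S → ∃[ css ] (All ClosedTrail css × concat css ↭ load S)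
    weave _ [] _ _ = [] , [] , ↭-refl
    weave (suc N) ((a , b , es , r) ∷ S) {root} (s≤s ≤N) even with a ≟ b
    ... | yes refl = es ∷ proj₁ ih , (a , r) ∷ proj₁ (proj₂ ih) , ++⁺ˡ es (proj₂ (proj₂ ih))
      where
      ih = weave N S ≤N (λ {v} v≢ → trans (sym (xor-cancel (δ v a) false (odd v S))) (even v≢))
    ... | no a≢b with a ≟ root
    ...   | no a≢root = join N S ≤N r a≢b a≢root even
    ...   | yes refl = join N S ≤N (flipped r) (≢-sym a≢b) (≢-sym a≢b) (λ {v} v≢ →
              trans (sym (xor-assoc (δ v b) _ _)) (trans (cong (_xor odd v S) (xor-comm (δ v b) (δ v a)))
                (trans (xor-assoc (δ v a) _ _) (even v≢))))

    join : ∀ N S {root c d es} → length S ≤ N → Trail c d es → c ≢ d → c ≢ root →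
           (∀ {v} → v ≢ root → δ v c xor (δ v d xor odd v S) ≡ false) →
           ∃[ css ] (All ClosedTrail css × concat css ↭ es ++ load S)
    join N S {root} {c} {d} {es} ≤N r c≢d c≢root even with extract S odd-c
      where
      -- Since `c` and `d` differ, the strand in hand has exactly one end at `c`, so the others have
      -- an odd number there.
      odd-c : odd c S ≡ true
      odd-c = begin
        odd c S                               ≡⟨ not-involutive (odd c S) ⟨
        not (false xor not (odd c S))         ≡⟨⟩
        not (true xor (false xor odd c S))    ≡⟨ cong₂ (λ y z → not (y xor (z xor odd c S))) (δ-≡ c) (δ-≢ c≢d) ⟨
        not (δ c c xor (δ c d xor odd c S))   ≡⟨ cong not (even c≢root) ⟩
        true                                  ∎
        where open ≡-Reasoning
    join (suc N) S {root} {c} {d} {es} ≤N r c≢d c≢root even | c′ , fs , r′ , S′ , σ , len , par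
      with weave (suc N) ((d , c′ , _ , flipped r ⟫ r′) ∷ S′) (ℕₚ.≤-trans (ℕₚ.≤-reflexive (sym len)) ≤N)
             (λ {v} v≢ → trans (sym (xor-cancel (δ v c) (δ v d) _))
               (trans (cong (λ z → δ v c xor (δ v d xor z)) (sym (par v))) (even v≢)))
    ... | css , closed , τ = css , closed ,
      ↭-trans τ (↭-trans (↭-reflexive (++-assoc es fs (load S′))) (++⁺ˡ es (↭-sym σ)))
    join zero S ≤N _ _ _ _ | _ , _ , _ , _ , _ , len , _ rewrite len with ≤N
    ... | ()

-- A spanning tree using each edge at most once.

module Spanning {n : ℕ} {H : Hypergraph n} (cov : Covering3 H) (4≤n : 4 ≤ n) where
  open Covering3 cov
  open Trails H
  open Decomposing cov
  open Triple

  _∈?_ : ∀ (v : Vertex) vs → Dec (v ∈ˡ vs)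
  v ∈? vs = Any.any? (v ≟_) vs

  missing : ∀ {xs ys : List Vertex} → Unique xs → length ys < length xs → ∃[ x ] (x ∈ˡ xs × x ∉ˡ ys)
  missing {xs} {ys} unique short with Any.any? (λ x → ¬? (x ∈? ys)) xs
  ... | yes found = find found
  ... | no none = contradiction (unique-bound unique xs⊆ys) (ℕₚ.<⇒≱ short)
    where
    xs⊆ys : ∀ {x} → x ∈ˡ xs → x ∈ˡ ys
    xs⊆ys {x} x∈ with x ∈? ys
    ... | yes x∈ys = x∈ys
    ... | no x∉ys = contradiction (lose x∈ x∉ys) none

  fresh : ∀ a b c → ∃[ v ] (v ≢ a × v ≢ b × v ≢ c)
  fresh a b c with missing {ys = a ∷ b ∷ c ∷ []} (allFin⁺ n) (ℕₚ.≤-trans 4≤n (ℕₚ.≤-reflexive (sym (length-tabulate {n = n} (λ i → i)))))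
  ... | v , _ , v∉ = v , (λ { refl → v∉ (here refl) }) , (λ { refl → v∉ (there (here refl)) })
                       , (λ { refl → v∉ (there (there (here refl))) })

  Inside : List Vertex → Edge → Set
  Inside M f = ∀ {v} → v ∈ edge H f → v ∈ˡ M

  Tag : Set
  Tag = Vertex × Vertex × Vertex

  Spans : Edge → Tag → Set
  Spans f (u , w , t) = ∀ {v} → v ∈ edge H f → v ≡ u ⊎ v ≡ w ⊎ v ≡ t

  Anchored : List Vertex → Tag → Set
  Anchored M (u , w , _) = u ∈ˡ M × w ∈ˡ M

  anchors : List Tag → List Vertex
  anchors [] = []
  anchors ((u , w , _) ∷ C) = u ∷ w ∷ anchors C

  -- The tree edges not contained in M are tagged by their two vertices in M and the one outside.
  -- There are too few of them to block the next vertex.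
  record Stage (M : List Vertex) (F : List Edge) (C : List Tag) : Set where
    field
      grow     : Grow M F
      anchored : All (Anchored M) C
      tagged   : ∀ {f} → f ∈ˡ F → Inside M f ⊎ Any (Spans f) C
      few      : length (anchors C) < length M
      2≤∣M∣    : 2 ≤ length M
  open Stage

  span-inside : ∀ {M f u w t} → Spans f (u , w , t) → u ∈ˡ M → w ∈ˡ M → t ∈ˡ M → Inside M f
  span-inside spans u∈ w∈ t∈ v∈ with spans v∈
  ... | inj₁ refl = u∈
  ... | inj₂ (inj₁ refl) = w∈
  ... | inj₂ (inj₂ refl) = t∈

  discard : ∀ {M F C u w t} → t ∈ˡ M → Stage M F ((u , w , t) ∷ C) → Stage M F C
  discard {M} {C = C} {u} {w} {t} t∈ s with anchored s
  ... | (u∈ , w∈) ∷ rest = record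
    { grow = grow s ; anchored = rest ; tagged = tagged′
    ; few = ℕₚ.≤-trans (ℕₚ.m≤n+m _ 2) (few s) ; 2≤∣M∣ = 2≤∣M∣ s }
    where
    tagged′ : ∀ {f} → f ∈ˡ _ → Inside M f ⊎ Any (Spans f) C
    tagged′ f∈ with tagged s f∈
    ... | inj₁ inside = inj₁ inside
    ... | inj₂ (here spans) = inj₁ (span-inside spans u∈ w∈ t∈)
    ... | inj₂ (there tag) = inj₂ tag

  -- By `few`, some `x` in `M` is no anchor. A used edge inside `M` misses `y`; a tagged one
  -- containing `x` has `x` as its outside vertex, so all its vertices are in `M` and it misses `y`
  -- too.
  attach : ∀ {M F C y} → Stage M F C → y ∉ˡ M →
           ∃[ x ] (x ∈ˡ M × Σ (Triple x y) λ τ → e τ ∉ˡ F)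
  attach {M} {F} {C} {y} s y∉ with missing (grow-uniqueᵛ (grow s)) (few s)
  ... | x , x∈ , x∉ = x , x∈ , τ , λ e∈ → blocked (tagged s e∈)
    where
    τ : Triple x y
    τ = triple λ { refl → y∉ x∈ }
    unanchored : ∀ C {f} → All (Anchored M) C → x ∉ˡ anchors C → x ∈ edge H f → y ∈ edge H f →
                 ¬ Any (Spans f) C
    unanchored _ (_ ∷ as) x∉ x∈f y∈f (there tag) = unanchored _ as (λ x∈ → x∉ (there (there x∈))) x∈f y∈f tag
    unanchored _ ((u∈ , w∈) ∷ _) x∉ x∈f y∈f (here spans) with spans x∈f | spans y∈f
    ... | inj₁ refl | _ = x∉ (here refl)
    ... | inj₂ (inj₁ refl) | _ = x∉ (there (here refl))
    ... | inj₂ (inj₂ refl) | inj₁ refl = y∉ u∈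
    ... | inj₂ (inj₂ refl) | inj₂ (inj₁ refl) = y∉ w∈
    ... | inj₂ (inj₂ refl) | inj₂ (inj₂ refl) = y∉ x∈
    blocked : ¬ (Inside M (e τ) ⊎ Any (Spans (e τ)) C)
    blocked (inj₁ inside) = y∉ (inside (b∈ τ))
    blocked (inj₂ tag) = unanchored C (anchored s) x∉ (a∈ τ) (b∈ τ) tag

  weaken : ∀ {M y} {C : List Tag} → All (Anchored M) C → All (Anchored (y ∷ M)) C
  weaken = All.map λ (u∈ , w∈) → there u∈ , there w∈

  -- The next vertex is the outside vertex `t` of a tag: that tag is released and the new edge takes
  -- its place, so the number of tags does not grow. Only when no tags are left is `y` itself added;
  -- the single new tag has two anchors, against at least three vertices.
  extend : ∀ {M F y} C → Stage M F C → y ∉ˡ M → ∃[ y′ ] ∃₂ λ F′ C′ → Stage (y′ ∷ M) F′ C′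
  extend {M} {F} {y} [] s y∉ with attach s y∉
  ... | x , x∈ , τ , e∉ = y , e τ ∷ F , (x , y , z τ) ∷ [] , record
    { grow = sprout (grow s) τ x∈ y∉ e∉ ; anchored = (there x∈ , here refl) ∷ []
    ; tagged = tagged′ ; few = s≤s (2≤∣M∣ s) ; 2≤∣M∣ = ℕₚ.m≤n⇒m≤1+n (2≤∣M∣ s) }
    where
    tagged′ : ∀ {f} → f ∈ˡ e τ ∷ F → Inside (y ∷ M) f ⊎ Any (Spans f) ((x , y , z τ) ∷ [])
    tagged′ (here refl) = inj₂ (here (within τ))
    tagged′ (there f∈) with tagged s f∈
    ... | inj₁ inside = inj₁ (λ v∈ → there (inside v∈))
  extend {M} {F} ((u , w , t) ∷ C) s y∉ with t ∈? M
  ... | yes t∈ = extend C (discard t∈ s) y∉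
  ... | no t∉ with attach s t∉ | anchored s
  ...   | x , x∈ , τ , e∉ | (u∈ , w∈) ∷ rest = t , e τ ∷ F , (x , t , z τ) ∷ C , record
    { grow = sprout (grow s) τ x∈ t∉ e∉ ; anchored = (there x∈ , here refl) ∷ weaken rest
    ; tagged = tagged′ ; few = ℕₚ.m≤n⇒m≤1+n (few s) ; 2≤∣M∣ = ℕₚ.m≤n⇒m≤1+n (2≤∣M∣ s) }
    where
    tagged′ : ∀ {f} → f ∈ˡ e τ ∷ F → Inside (t ∷ M) f ⊎ Any (Spans f) ((x , t , z τ) ∷ C)
    tagged′ (here refl) = inj₂ (here (within τ))
    tagged′ (there f∈) with tagged s f∈
    ... | inj₁ inside = inj₁ (λ v∈ → there (inside v∈))
    ... | inj₂ (here spans) = inj₁ (span-inside spans (there u∈) (there w∈) (here refl))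
    ... | inj₂ (there tag) = inj₂ (there tag)

  complete : ∀ N {M F C} → Stage M F C → n ≤ N + length M → ∃₂ λ M′ F′ → Grow M′ F′ × (∀ v → v ∈ˡ M′)
  complete N {M} {F} {C} s n≤ with any? (λ v → ¬? (v ∈? M))
  ... | no none = M , F , grow s , λ v → decidable-stable (v ∈? M) (λ v∉ → none (v , v∉))
  complete (suc N) {M} {C = C} s n≤ | yes (v , v∉) with extend C s v∉
  ... | _ , _ , _ , s′ = complete N s′ (ℕₚ.≤-trans n≤ (ℕₚ.≤-reflexive (sym (ℕₚ.+-suc N (length M)))))
  complete zero {M} s n≤ | yes (v , v∉) = contradiction
    (ℕₚ.≤-trans (unique-bound (insert v∉ (grow-uniqueᵛ (grow s))) (λ {x} _ → ∈-allFin x))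
      (ℕₚ.≤-trans (ℕₚ.≤-reflexive (length-tabulate {n = n} (λ i → i))) n≤))
    (ℕₚ.<⇒≱ (ℕₚ.n<1+n (length M)))

  Start : Set
  Start = ∃[ M ] ∃₂ λ F C → Stage M F C

  rotate : ∀ {a b} (τ : Triple a b) → Triple (z τ) a
  rotate τ = record { e = e τ ; z = _ ; a≢b = z≢a τ ; a∈ = z∈ τ ; b∈ = a∈ τ ; z∈ = b∈ τ
                    ; z≢a = ≢-sym (z≢b τ) ; z≢b = ≢-sym (a≢b τ) }

  mirror : ∀ {a b} → Triple a b → Triple b a
  mirror τ = record { e = e τ ; z = z τ ; a≢b = ≢-sym (a≢b τ) ; a∈ = b∈ τ ; b∈ = a∈ τ ; z∈ = z∈ τ
                    ; z≢a = z≢b τ ; z≢b = z≢a τ }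

  avoids : ∀ {a b x} (τ : Triple a b) → x ≢ a → x ≢ b → x ≢ z τ → ¬ x ∈ edge H (e τ)
  avoids τ x≢a x≢b x≢z x∈ with within τ x∈
  ... | inj₁ x≡a = x≢a x≡a
  ... | inj₂ (inj₁ x≡b) = x≢b x≡b
  ... | inj₂ (inj₂ x≡z) = x≢z x≡z

  differ : ∀ {x f g} → x ∈ edge H f → ¬ x ∈ edge H g → f ≢ g
  differ x∈ x∉ refl = x∉ x∈

  start-overlapping : ∀ {v w} (σ : Triple v w) (ρ : Triple (z σ) v) → e ρ ≢ e σ → Start
  start-overlapping {v} {w} σ ρ ρ≢σ = v ∷ w ∷ z σ ∷ [] , _ , (z σ , v , z ρ) ∷ [] , record
    { grow = sprout (sprout (seed (z σ)) (rotate (mirror σ)) (here refl)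
                      (λ { (here w≡z) → z≢b σ (sym w≡z) }) λ ())
                    ρ (there (here refl))
                    (λ { (here v≡w) → a≢b σ v≡w ; (there (here v≡z)) → z≢a σ (sym v≡z) })
                    (λ { (here eq) → ρ≢σ eq })
    ; anchored = (there (there (here refl)) , here refl) ∷ []
    ; tagged = λ { (here refl) → inj₂ (here (within ρ))
                 ; (there (here refl)) → inj₁ (span-inside (within σ) (here refl) (there (here refl))
                                                 (there (there (here refl)))) }
    ; few = ℕₚ.≤-refl
    ; 2≤∣M∣ = s≤s (s≤s z≤n) }

  -- The edges of `σ` and `ρ` meet in `z σ` only. The tree reads `σ` as `z σ` to `v`, `ρ` as `z σ`
  -- to `y`, `π` as `y` to `w` and `ω` as `v` to `z ρ`. The first two lie inside the five vertices,
  -- so two tags with four anchors remain.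
  start-spread : ∀ {v w y} (σ : Triple v w) (ρ : Triple (z σ) y) → y ≢ v → y ≢ w → z ρ ≢ v → z ρ ≢ w → Start
  start-spread {v} {w} {y} σ ρ y≢v y≢w z≢v z≢w =
    z ρ ∷ w ∷ y ∷ v ∷ z σ ∷ [] , _ , (v , z ρ , z ω) ∷ (y , w , z π) ∷ [] , record
    { grow = sprout (sprout (sprout (sprout (seed (z σ))
               (rotate σ) (here refl) (λ { (here v≡z) → z≢a σ (sym v≡z) }) λ ())
               ρ (there (here refl))
                 (λ { (here y≡v) → y≢v y≡v ; (there (here y≡z)) → a≢b ρ (sym y≡z) })
                 (λ { (here eq) → ρ≢σ eq }))
               π (here refl)
                 (λ { (here w≡y) → y≢w (sym w≡y) ; (there (here w≡v)) → a≢b σ (sym w≡v)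
                    ; (there (there (here w≡z))) → z≢b σ (sym w≡z) })
                 (λ { (here eq) → π≢ρ eq ; (there (here eq)) → π≢σ eq }))
               ω (there (there (here refl)))
                 (λ { (here z≡w) → z≢w z≡w ; (there (here z≡y)) → z≢b ρ z≡y
                    ; (there (there (here z≡v))) → z≢v z≡v
                    ; (there (there (there (here z≡z)))) → z≢a ρ z≡z })
                 (λ { (here eq) → ω≢π eq ; (there (here eq)) → ω≢ρ eq ; (there (there (here eq))) → ω≢σ eq })
    ; anchored = (there (there (there (here refl))) , here refl) ∷ (there (there (here refl)) , there (here refl)) ∷ []
    ; tagged = λ { (here refl) → inj₂ (here (within ω))
                 ; (there (here refl)) → inj₂ (there (here (within π)))
                 ; (there (there (here refl))) → inj₁ (span-inside (within ρ)
                     (there (there (there (there (here refl))))) (there (there (here refl))) (here refl))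
                 ; (there (there (there (here refl)))) → inj₁ (span-inside (within σ)
                     (there (there (there (here refl)))) (there (here refl))
                     (there (there (there (there (here refl)))))) }
    ; few = ℕₚ.≤-refl
    ; 2≤∣M∣ = s≤s (s≤s z≤n) }
    where
    π : Triple y w
    π = triple y≢w
    ω : Triple v (z ρ)
    ω = triple (≢-sym z≢v)
    v∉ρ : ¬ v ∈ edge H (e ρ)
    v∉ρ = avoids ρ (≢-sym (z≢a σ)) (≢-sym y≢v) (≢-sym z≢v)
    w∉ρ : ¬ w ∈ edge H (e ρ)
    w∉ρ = avoids ρ (≢-sym (z≢b σ)) (≢-sym y≢w) (≢-sym z≢w)
    y∉σ : ¬ y ∈ edge H (e σ)
    y∉σ = avoids σ y≢v y≢w (≢-sym (a≢b ρ))
    ρ≢σ : e ρ ≢ e σ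
    ρ≢σ = differ (b∈ ρ) y∉σ
    π≢σ : e π ≢ e σ
    π≢σ = differ (a∈ π) y∉σ
    π≢ρ : e π ≢ e ρ
    π≢ρ = differ (b∈ π) w∉ρ
    ω≢ρ : e ω ≢ e ρ
    ω≢ρ = differ (a∈ ω) v∉ρ
    ω≢σ : e ω ≢ e σ
    ω≢σ = differ (b∈ ω) (avoids σ z≢v z≢w (z≢a ρ))
    ω≢π : e ω ≢ e π
    -- Either `π` consists of `y`, `w`, `v` and misses `z ρ`, or it misses `v`; `ω` contains both.
    ω≢π with v ≟ z π
    ... | yes refl = differ (b∈ ω) (avoids π (z≢b ρ) z≢w z≢v)
    ... | no v≢z = differ (a∈ ω) (avoids π (≢-sym y≢v) (a≢b σ) v≢z)

  -- One vertex is too few for `Stage`, and two vertices joined by one tagged edge already give two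
  -- anchors. Hence the start from two edges through `z σ`; whether they share a second vertex
  -- decides the shape.
  start : Vertex → Start
  start v with fresh v v v
  ... | w , w≢v , _ with triple (≢-sym w≢v)
  ...   | σ with fresh v w (z σ)
  ...     | y , y≢v , y≢w , y≢z with triple (≢-sym y≢z)
  ...       | ρ with z ρ ≟ v | z ρ ≟ w
  ...         | no z≢v | no z≢w = start-spread σ ρ y≢v y≢w z≢v z≢w
  ...         | yes z≡v | _ = start-overlapping σ
    (record { e = e ρ ; z = y ; a≢b = z≢a σ ; a∈ = a∈ ρ ; b∈ = subst (_∈ edge H (e ρ)) z≡v (z∈ ρ)
            ; z∈ = b∈ ρ ; z≢a = y≢z ; z≢b = y≢v })
    (differ (b∈ ρ) (avoids σ y≢v y≢w y≢z))
  ...         | no _ | yes z≡w = start-overlapping (mirror σ)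
    (record { e = e ρ ; z = y ; a≢b = z≢b σ ; a∈ = a∈ ρ ; b∈ = subst (_∈ edge H (e ρ)) z≡w (z∈ ρ)
            ; z∈ = b∈ ρ ; z≢a = y≢z ; z≢b = y≢w })
    (differ (b∈ ρ) (avoids σ y≢v y≢w y≢z))

  two-vertices : ∀ f → ∃₂ λ u v → u ∈ edge H f × v ∈ edge H f × u ≢ v
  two-vertices f with Sub.nonempty? (edge H f)
  ... | no empty = contradiction (trans (sym (cong ∣_∣ (Sub.Empty-unique empty))) (uniform f))
    (λ eq → case trans (sym (Sub.∣⊥∣≡0 n)) eq of λ ())
  ... | yes (u , u∈) with any? (λ v → v Sub.∈? edge H f ×-dec ¬? (u ≟ v))
  ...   | yes (v , v∈ , u≢v) = u , v , u∈ , v∈ , u≢v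
  ...   | no alone = contradiction (Sub.p⊆q⇒∣p∣≤∣q∣ f⊆⁅u⁆) too-big
    where
    f⊆⁅u⁆ : edge H f ⊆ ⁅ u ⁆
    f⊆⁅u⁆ {v} v∈ with u ≟ v
    ... | yes refl = Sub.x∈⁅x⁆ u
    ... | no u≢v = contradiction (v , v∈ , u≢v) alone
    too-big : ¬ ∣ edge H f ∣ ≤ ∣ ⁅ u ⁆ ∣
    too-big rewrite uniform f | Sub.∣⁅x⁆∣≡1 u = λ { (s≤s ()) }

  single : Edge → Strand
  single f with two-vertices f
  ... | u , v , u∈ , v∈ , u≢v = u , v , [ f ] , hop u∈ v∈ u≢v

  load-singles : ∀ fs → load (map single fs) ≡ fs
  load-singles [] = refl
  load-singles (f ∷ fs) = cong (f ∷_) (load-singles fs)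

  ClosedFamily : Set
  ClosedFamily = ∃[ css ] (All ClosedTrail css × concat css ↭ allFin (m H))

  -- Each edge off the tree becomes an arc between two arbitrary vertices of it; the tree then
  -- corrects the parities.
  grown-family : ∀ {M F} → Grow M F → (∀ v → v ∈ˡ M) → ClosedFamily
  grown-family {F = F} g spanning =
    let rest , σ = complement (grow-uniqueᵉ g) (λ {f} _ → ∈-allFin f)
        root , S , even , τ = settle g (map single rest) (λ {v} v∉ → contradiction (spanning v) v∉)
        css , closed , ρ = weave (length S) S ℕₚ.≤-refl even
    in css , closed , ↭-trans ρ (↭-trans τ (↭-trans (↭-reflexive (cong (F ++_) (load-singles rest))) σ))

  closed-family : Vertex → ClosedFamily
  closed-family v =
    let M , _ , _ , s = start v
        _ , _ , g , spanning = complete n s (ℕₚ.m≤m+n n (length M))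
    in grown-family g spanning

-- Euler tours by finite search.

module Touring {n : ℕ} {H : Hypergraph n} (cov : Covering3 H) where
  open Covering3 cov
  open Trails H

  -- A path presented by its edge list, the vertices being quantified over a finite set; this makes
  -- its existence decidable.
  Route : Vertex → Vertex → List Edge → Set
  Route a b [] = a ≡ b
  Route a b (e ∷ es) = ∃[ c ] (a ∈ edge H e × c ∈ edge H e × a ≢ c × Route c b es)

  route? : ∀ a b es → Dec (Route a b es)
  route? a b [] = a ≟ b
  route? a b (e ∷ es) = any? λ c →
    a Sub.∈? edge H e ×-dec c Sub.∈? edge H e ×-dec ¬? (a ≟ c) ×-dec route? c b es

  any-list? : ∀ k {P : List Edge → Set} → (∀ es → Dec (P es)) → Dec (∃[ es ] (length es ≡ k × P es))
  any-list? zero P? with P? []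
  ... | yes p = yes ([] , refl , p)
  ... | no ¬p = no λ { ([] , _ , p) → ¬p p }
  any-list? (suc k) P? with any? (λ e → any-list? k (λ es → P? (e ∷ es)))
  ... | yes (e , es , len , p) = yes (e ∷ es , cong suc len , p)
  ... | no none = no λ { (e ∷ es , len , p) → none (e , es , ℕₚ.suc-injective len , p) }

  Tours : List Edge → Set
  Tours es = Unique es × (∀ e → e ∈ˡ es) × ∃[ v ] Route v v es

  tours? : ∀ es → Dec (Tours es)
  tours? es = unique? _≟_ es ×-dec all? (λ e → Any.any? (e ≟_) es) ×-dec any? (λ v → route? v v es)

  path-route : ∀ {a b ks} → Path a b ks → Route a b (edges ks)
  path-route [] = refl
  path-route (step k refl p) = tgt k , src∈ k , tgt∈ k , src≢tgt k , path-route p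

  trail-tours : ∀ {v} → Trail v v (allFin (m H)) → ∃[ es ] (length es ≡ m H × Tours es)
  trail-tours {v} (ks , p , σ) = edges ks , trans (↭-length σ) (length-tabulate {n = m H} (λ i → i))
    , Unique-resp-↭ (setoid _) (↭⇒↭ₛ (↭-sym σ)) (allFin⁺ (m H)) , (λ e → ∈-resp-↭ (↭-sym σ) (∈-allFin e)) , v , path-route p

  vertices : ∀ {a b} es → Route a b es → Fin (suc (length es)) → Vertex
  vertices {a} _ _ zero = a
  vertices (e ∷ es) (_ , _ , _ , _ , r) (suc i) = vertices es r i

  route-walk : ∀ {a b} es → Route a b es → Walk H (length es)
  route-walk es r = record
    { vtx = vertices es r ; edg = lookup es ; inˡ = inl es r ; inʳ = inr es r ; step≢ = apart es r }
    where
    inl : ∀ {a b} es (r : Route a b es) i → vertices es r (inject₁ i) ∈ edge H (lookup es i)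
    inl (e ∷ es) (_ , a∈ , _) zero = a∈
    inl (e ∷ es) (_ , _ , _ , _ , r) (suc i) = inl es r i
    inr : ∀ {a b} es (r : Route a b es) i → vertices es r (suc i) ∈ edge H (lookup es i)
    inr (e ∷ es) (_ , _ , c∈ , _) zero = c∈
    inr (e ∷ es) (_ , _ , _ , _ , r) (suc i) = inr es r i
    apart : ∀ {a b} es (r : Route a b es) i → vertices es r (inject₁ i) ≢ vertices es r (suc i)
    apart (e ∷ es) (_ , _ , _ , a≢c , _) zero = a≢c
    apart (e ∷ es) (_ , _ , _ , _ , r) (suc i) = apart es r i

  route-end : ∀ {a b} es (r : Route a b es) → vertices es r (fromℕ (length es)) ≡ b
  route-end [] a≡b = a≡b
  route-end (e ∷ es) (_ , _ , _ , _ , r) = route-end es r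

  lookup-injective : ∀ (es : List Edge) → Unique es → ∀ {i j} → lookup es i ≡ lookup es j → i ≡ j
  lookup-injective (_ ∷ _) _ {zero} {zero} _ = refl
  lookup-injective (_ ∷ _) (e∉ ∷ _) {zero} {suc j} eq = contradiction eq (All.lookup e∉ (∈-lookup j))
  lookup-injective (_ ∷ _) (e∉ ∷ _) {suc i} {zero} eq = contradiction (sym eq) (All.lookup e∉ (∈-lookup i))
  lookup-injective (_ ∷ es) (_ ∷ u) {suc i} {suc j} eq = cong suc (lookup-injective es u eq)

  2≤length : ∀ {v} es → (∀ e → e ∈ˡ es) → Route v v es → 2 ≤ length es
  2≤length [] complete _ with m H | nonempty | complete
  ... | suc _ | _ | c = case c zero of λ ()
  2≤length (e ∷ []) _ (_ , _ , _ , v≢c , c≡v) = contradiction (sym c≡v) v≢c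
  2≤length (_ ∷ _ ∷ _) _ _ = s≤s (s≤s z≤n)

  tours-eulerian : ∀ {es} → Tours es → Eulerian H
  tours-eulerian {es} (unique , complete , v , r) = inj₂ (length es , route-walk es r
    , (sym (route-end es r) , 2≤length es complete r)
    , lookup-injective es unique
    , λ e → index (complete e) , λ { refl → sym (lookup-index (complete e)) })

  -- Merging only refutes the absence of a tour; searching all edge lists of length `m H` turns this
  -- into an actual tour.
  eulerian : Vertex → 4 ≤ n → Eulerian H
  eulerian v 4≤n = conclude (any-list? (m H) tours?)
    where
    conclude : Dec (∃[ es ] (length es ≡ m H × Tours es)) → Eulerian H
    conclude (yes (_ , _ , tours)) = tours-eulerian tours
    conclude (no no-tours) =
      let css , closed , σ = Spanning.closed-family cov 4≤n v
      in ⊥-elim (Merging.no-family cov (λ c → no-tours (trail-tours c)) (length css) css ℕₚ.≤-refl closed σ)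

theorem4p13 : ∀ (n : ℕ) → 7 ≤ n → (H : Hypergraph n) → Covering3 H → Eulerian H
theorem4p13 zero () H cov
theorem4p13 (suc n) 7≤n H cov =
  Touring.eulerian cov zero (ℕₚ.≤-trans (s≤s (s≤s (s≤s (s≤s z≤n)))) 7≤n)
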